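{- The problem ECI (given a time-inconsistent planning model $M=(G,w,s,t,p,\beta)$ and $W\ge 0$, compute $\Pr(X_\beta\le W)$) is solvable in time $2^{\operatorname{fes}(G)}\cdot \mathrm{poly}(n)$, where $n$ is the number of vertices of $G$.
   Context: A time-inconsistent planning model is a tuple $M=(G,w,s,t,p,\beta)$ where $G$ is a finite directed acyclic graph with $n$ vertices, $w:E(G)\to\mathbb{N}$ are arc costs, $s,t\in V(G)$ with $t$ reachable from $s$, and $\beta\le 1$ is the present-bias parameter. For a $v$-$t$ path $P$ with arcs $e_1,\dots,e_m$, its perceived cost is $\zeta(P)=w(e_1)+\beta\sum_{i=2}^m w(e_i)$; $\zeta(v)$ is the minimum perceived cost over all $v$-$t$ paths, and a $v$-$t$ path attaining it is a perceived path. The function $p$ assigns to each arc $uv$ a probability $p(u,v)\ge 0$ such that $\sum_{uv\in E(G)}p(u,v)=1$ for every vertex $u\ne t$ from which $t$ is reachable, and $p(u,v)>0$ only if $uv$ is the first arc of some perceived $u$-$t$ path. The agent starts at $s$ and at each vertex $u\neq t$ moves along arc $uv$ with probability $p(u,v)$, until it reaches $t$. $C_\beta$ is the random variable equal to the actual cost (sum of $w$) of the $s$-$t$ path traversed, $d(s,t)$ is the minimum cost of an $s$-$t$ path, and $X_\beta=C_\beta/d(s,t)$. $\operatorname{fes}(G)$ is the minimum size of a feedback edge set of the underlying undirected graph of $G$ (a set of edges whose removal makes it a forest).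
   Formalization: The present-bias parameter β, the probabilities p(u,v) and the threshold W are taken to be rational numbers; running time is counted in unit-cost arithmetic steps, and d(s,t) is assumed nonzero so that X_β is defined. -}

module Defs where

open import Data.Bool.Base using (Bool; true; false; T; if_then_else_; not; _∧_)
open import Data.Bool.Properties using (T?)
open import Data.Fin.Base as Fin using (Fin; toℕ; fromℕ<)
import Data.Fin.Properties as Fin
open import Data.Integer.Base using (+_)
open import Data.List.Base using (List; []; _∷_; _∷ʳ_; map; foldr; concatMap; allFin; length)
open import Data.List.Membership.Propositional using (_∉_)
open import Data.List.Relation.Unary.All using (All)
open import Data.List.Relation.Unary.Linked using (Linked)
open import Data.List.Relation.Unary.Unique.Propositional using (Unique)
open import Data.Nat.Base as ℕ using (ℕ; zero; suc; _≡ᵇ_; _<ᵇ_)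
import Data.Nat.Properties as ℕ
open import Data.Product.Base using (Σ-syntax; ∃-syntax; _×_; _,_)
open import Data.Rational.Base as ℚ using (ℚ; 0ℚ; 1ℚ; _/_)
import Data.Rational.Properties as ℚ
open import Data.Sum.Base using (_⊎_)
open import Relation.Binary.PropositionalEquality using (_≡_; _≢_; refl)
open import Relation.Nullary using (¬_; yes; no; does)
open import Relation.Unary using (Decidable)

ℕ→ℚ : ℕ → ℚ
ℕ→ℚ k = + k / 1

sumℚ : List ℚ → ℚ
sumℚ = foldr ℚ._+_ 0ℚ

-- Polynomials with natural coefficients, constant coefficient first.

Poly : Set
Poly = List ℕ

evalPoly : Poly → ℕ → ℕ
evalPoly []      x = 0
evalPoly (a ∷ q) x = a ℕ.+ x ℕ.* evalPoly q x

------------------------------------------------------------------------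
-- Directed acyclic graphs

module Digraph {n : ℕ} (adj : Fin n → Fin n → Bool) where

  Arc : Fin n → Fin n → Set
  Arc u v = T (adj u v)

  infixr 5 _∷_

  -- In an acyclic graph every directed walk is a path, so no
  -- distinctness condition is needed.
  data Path : Fin n → Fin n → Set where
    []  : ∀ {u} → Path u u
    _∷_ : ∀ {u v x} → Arc u v → Path v x → Path u x

record DAG (n : ℕ) : Set where
  field
    adj : Fin n → Fin n → Bool
  open Digraph adj public
  field
    acyclic : ∀ {u v} → Arc u v → ¬ Path v u

------------------------------------------------------------------------
-- Feedback edge sets of the underlying undirected graph

record Cycle {V : Set} (_~_ : V → V → Set) : Set where
  field
    start    : V
    rest     : List V
    long     : 2 ℕ.≤ length rest
    distinct : Unique (start ∷ rest)
    closed   : Linked _~_ (start ∷ rest ∷ʳ start)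

Forest : {V : Set} → (V → V → Set) → Set
Forest _~_ = ¬ Cycle _~_

module _ {n : ℕ} (G : DAG n) where
  open DAG G

  UAdj : Fin n → Fin n → Set
  UAdj u v = Arc u v ⊎ Arc v u

  -- The undirected edge {u , v} is represented by the pair (u , v) with u < v.
  UEdge : Fin n × Fin n → Set
  UEdge (u , v) = u Fin.< v × UAdj u v

  UAdjWithout : List (Fin n × Fin n) → Fin n → Fin n → Set
  UAdjWithout S u v = UAdj u v × (u , v) ∉ S × (v , u) ∉ S

  record IsFeedbackEdgeSet (S : List (Fin n × Fin n)) : Set where
    field
      edges  : All UEdge S
      unique : Unique S
      forest : Forest (UAdjWithout S)

  -- fes(G) = k
  record IsFes (k : ℕ) : Set where
    field
      attained : ∃[ S ] IsFeedbackEdgeSet S × length S ≡ k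
      minimal  : ∀ S → IsFeedbackEdgeSet S → k ℕ.≤ length S

------------------------------------------------------------------------
-- Time-inconsistent planning models

-- Arc functions are given on all pairs of vertices; their values on
-- non-arcs are arbitrary and play no role.

module Costs {n : ℕ} (G : DAG n) (w : Fin n → Fin n → ℕ) (β : ℚ) where
  open DAG G

  cost : ∀ {u v} → Path u v → ℕ
  cost []                  = 0
  cost (_∷_ {u} {v} _ P) = w u v ℕ.+ cost P

  ζ : ∀ {u v} → Path u v → ℚ
  ζ []                  = 0ℚ
  ζ (_∷_ {u} {v} _ P) = ℕ→ℚ (w u v) ℚ.+ β ℚ.* ℕ→ℚ (cost P)

  Perceived : ∀ {u v} → Path u v → Set
  Perceived {u} {v} P = (Q : Path u v) → ζ P ℚ.≤ ζ Q

record PlanningModel (n : ℕ) : Set where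
  field
    G         : DAG n
    w         : Fin n → Fin n → ℕ
    s t       : Fin n
    p         : Fin n → Fin n → ℚ
    β         : ℚ
  open DAG G public
  open Costs G w β public
  field
    β≤1       : β ℚ.≤ 1ℚ
    reachable : Path s t
    p-nonneg  : ∀ {u v} → Arc u v → 0ℚ ℚ.≤ p u v
    p-sum     : ∀ {u} → u ≢ t → Path u t →
                sumℚ (map (λ v → if adj u v then p u v else 0ℚ) (allFin n)) ≡ 1ℚ
    p-support : ∀ {u v} (e : Arc u v) → 0ℚ ℚ.< p u v →
                Σ[ P ∈ Path v t ] Perceived (e ∷ P)

-- Finitely supported distributions, as lists of weighted outcomes.

Dist : Set → Set
Dist A = List (ℚ × A)

Pr : {A : Set} {E : A → Set} → Dist A → Decidable E → ℚ
Pr D E? = sumℚ (map (λ (q , x) → if does (E? x) then q else 0ℚ) D)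

module _ {n : ℕ} (M : PlanningModel n) where
  open PlanningModel M

  -- The path traversed by the agent from u, restricted to the event that
  -- it reaches t after at most the given number of moves.
  traversal : ℕ → (u : Fin n) → Dist (Path u t)
  traversal k u with u Fin.≟ t
  traversal k       u | yes refl = (1ℚ , []) ∷ []
  traversal zero    u | no _     = []
  traversal (suc k) u | no _     = concatMap move (allFin n)
    where
    move : Fin n → Dist (Path u t)
    move v with T? (adj u v)
    ... | yes e = map (λ (q , P) → p u v ℚ.* q , e ∷ P) (traversal k v)
    ... | no _  = []

  -- By acyclicity n moves always suffice.
  traversedPath : Dist (Path s t)
  traversedPath = traversal n s

  -- d(s,t) = d
  record IsDistance (d : ℕ) : Set where
    field
      attained : Σ[ P ∈ Path s t ] cost P ≡ d
      minimal  : (P : Path s t) → d ℕ.≤ cost P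

  -- X_β, as a function of the traversed path, where d = d(s,t)
  X : (d : ℕ) .{{_ : ℕ.NonZero d}} → Path s t → ℚ
  X d P = + cost P / d

  Pr[X≤_] : ℚ → (d : ℕ) .{{_ : ℕ.NonZero d}} → ℚ
  Pr[X≤ W ] d = Pr traversedPath (λ P → X d P ℚ.≤? W)

------------------------------------------------------------------------
-- Unit-cost random access machine over ℚ, in structured form

-- The memory consists of two-dimensional unbounded arrays, in two sorts:
-- index arrays hold natural numbers and number arrays hold rationals.
-- Arrays are named by natural numbers fixed in the program.  Indices
-- support only addition and truncated subtraction, numbers only the ring
-- operations, and numbers cannot be converted to indices; so unit cost
-- gives no access to the binary digits of numbers.

record Memory : Set where
  field
    idx : ℕ → ℕ → ℕ → ℕ
    num : ℕ → ℕ → ℕ → ℚ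
open Memory public

update : {A : Set} → (ℕ → ℕ → ℕ → A) → ℕ → ℕ → ℕ → A → (ℕ → ℕ → ℕ → A)
update f a i j x b k l =
  if (a ≡ᵇ b) ∧ (i ≡ᵇ k) ∧ (j ≡ᵇ l) then x else f b k l

data IExp : Set where
  lit       : ℕ → IExp
  _[_,_]    : ℕ → IExp → IExp → IExp
  _⊕_ _⊖_   : IExp → IExp → IExp

data NExp : Set where
  lit         : ℚ → NExp
  _[_,_]      : ℕ → IExp → IExp → NExp
  _⊕_ _⊖_ _⊗_ : NExp → NExp → NExp

data BExp : Set where
  _==_ _<<_ : IExp → IExp → BExp
  _≼_       : NExp → NExp → BExp
  neg       : BExp → BExp
  _&&_      : BExp → BExp → BExp

data Program : Set where
  skip            : Program
  idx_[_,_]≔_     : ℕ → IExp → IExp → IExp → Program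
  num_[_,_]≔_     : ℕ → IExp → IExp → NExp → Program
  _⨾_             : Program → Program → Program
  ifte            : BExp → Program → Program → Program
  while           : BExp → Program → Program

infix  8 _[_,_]
infixl 7 _⊗_
infixl 6 _⊕_ _⊖_
infix  5 _==_ _<<_ _≼_
infixr 4 _&&_
infix  3 idx_[_,_]≔_ num_[_,_]≔_
infixr 2 _⨾_

evalI : IExp → Memory → ℕ
evalI (lit k)       m = k
evalI (a [ i , j ]) m = idx m a (evalI i m) (evalI j m)
evalI (x ⊕ y)       m = evalI x m ℕ.+ evalI y m
evalI (x ⊖ y)       m = evalI x m ℕ.∸ evalI y m

evalN : NExp → Memory → ℚ
evalN (lit q)       m = q
evalN (a [ i , j ]) m = num m a (evalI i m) (evalI j m)
evalN (x ⊕ y)       m = evalN x m ℚ.+ evalN y m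
evalN (x ⊖ y)       m = evalN x m ℚ.- evalN y m
evalN (x ⊗ y)       m = evalN x m ℚ.* evalN y m

evalB : BExp → Memory → Bool
evalB (x == y) m = evalI x m ≡ᵇ evalI y m
evalB (x << y) m = evalI x m <ᵇ evalI y m
evalB (x ≼ y)  m = evalN x m ℚ.≤ᵇ evalN y m
evalB (neg b)  m = not (evalB b m)
evalB (b && c) m = evalB b m ∧ evalB c m

-- Evaluation time: one unit for each node of the expression.

timeI : IExp → ℕ
timeI (lit k)       = 1
timeI (a [ i , j ]) = suc (timeI i ℕ.+ timeI j)
timeI (x ⊕ y)       = suc (timeI x ℕ.+ timeI y)
timeI (x ⊖ y)       = suc (timeI x ℕ.+ timeI y)

timeN : NExp → ℕ
timeN (lit q)       = 1
timeN (a [ i , j ]) = suc (timeI i ℕ.+ timeI j)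
timeN (x ⊕ y)       = suc (timeN x ℕ.+ timeN y)
timeN (x ⊖ y)       = suc (timeN x ℕ.+ timeN y)
timeN (x ⊗ y)       = suc (timeN x ℕ.+ timeN y)

timeB : BExp → ℕ
timeB (x == y) = suc (timeI x ℕ.+ timeI y)
timeB (x << y) = suc (timeI x ℕ.+ timeI y)
timeB (x ≼ y)  = suc (timeN x ℕ.+ timeN y)
timeB (neg b)  = suc (timeB b)
timeB (b && c) = suc (timeB b ℕ.+ timeB c)

-- Run c m m′ τ: started in memory m, the program c halts in memory m′
-- after τ time units.

data Run : Program → Memory → Memory → ℕ → Set where
  skip  : ∀ {m} → Run skip m m 1
  idx≔  : ∀ {a i j e m} →
          Run (idx a [ i , j ]≔ e) m
              (record m { idx = update (idx m) a (evalI i m) (evalI j m) (evalI e m) })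
              (suc (timeI i ℕ.+ timeI j ℕ.+ timeI e))
  num≔  : ∀ {a i j e m} →
          Run (num a [ i , j ]≔ e) m
              (record m { num = update (num m) a (evalI i m) (evalI j m) (evalN e m) })
              (suc (timeI i ℕ.+ timeI j ℕ.+ timeN e))
  seq   : ∀ {c₁ c₂ m m′ m″ τ₁ τ₂} →
          Run c₁ m m′ τ₁ → Run c₂ m′ m″ τ₂ → Run (c₁ ⨾ c₂) m m″ (τ₁ ℕ.+ τ₂)
  then′ : ∀ {b c₁ c₂ m m′ τ} → evalB b m ≡ true →
          Run c₁ m m′ τ → Run (ifte b c₁ c₂) m m′ (suc (timeB b ℕ.+ τ))
  else′ : ∀ {b c₁ c₂ m m′ τ} → evalB b m ≡ false →
          Run c₂ m m′ τ → Run (ifte b c₁ c₂) m m′ (suc (timeB b ℕ.+ τ))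
  stop  : ∀ {b c m} → evalB b m ≡ false →
          Run (while b c) m m (suc (timeB b))
  loop  : ∀ {b c m m′ m″ τ₁ τ₂} → evalB b m ≡ true →
          Run c m m′ τ₁ → Run (while b c) m′ m″ τ₂ →
          Run (while b c) m m″ (suc (timeB b ℕ.+ τ₁ ℕ.+ τ₂))

------------------------------------------------------------------------
-- Input and output of ECI

tabulate₂ : {A : Set} {n : ℕ} → A → (Fin n → Fin n → A) → ℕ → ℕ → A
tabulate₂ {n = n} z f i j with i ℕ.<? n | j ℕ.<? n
... | yes i<n | yes j<n = f (fromℕ< i<n) (fromℕ< j<n)
... | _       | _       = z

-- idx 0 [0,0] = n,  idx 1 [0,0] = s,  idx 2 [0,0] = t,
-- idx 3 = adjacency matrix,
-- num 0 [0,0] = W,  num 1 [0,0] = β,  num 2 = w,  num 3 = p,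
-- and every other cell is 0.

input : {n : ℕ} → PlanningModel n → ℚ → Memory
input {n} M W = record { idx = idx₀ ; num = num₀ }
  where
  open PlanningModel M

  idx₀ : ℕ → ℕ → ℕ → ℕ
  idx₀ 0 0 0 = n
  idx₀ 1 0 0 = toℕ s
  idx₀ 2 0 0 = toℕ t
  idx₀ 3 i j = tabulate₂ 0 (λ u v → if adj u v then 1 else 0) i j
  idx₀ _ _ _ = 0

  num₀ : ℕ → ℕ → ℕ → ℚ
  num₀ 0 0 0 = W
  num₀ 1 0 0 = β
  num₀ 2 i j = tabulate₂ 0ℚ (λ u v → ℕ→ℚ (w u v)) i j
  num₀ 3 i j = tabulate₂ 0ℚ p i j
  num₀ _ _ _ = 0ℚ

output : Memory → ℚ
output m = num m 0 0 0

{-# OPTIONS --safe #-}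
module Submission where

-- The agent's random path is the list `traversal n s` of all s-t paths, so it
-- suffices to enumerate that list with costs and probabilities: d(s,t) is the
-- least cost that occurs, and the answer is the total probability of the
-- entries of cost at most W · d(s,t).  The lists for all vertices and all step
-- bounds are built by dynamic programming, one entry at a time, so the running
-- time is polynomial in n times the length of the longest list.
--
-- Each list has at most 2^|S| entries for every feedback edge set S, since a
-- path from u to t is determined by the edges of S that it uses: if two paths
-- first diverge at a vertex, follow both to the first vertex where they meet
-- again; by acyclicity these segments form a simple cycle, none of whose edges
-- is shared by the two paths, so if they use the same edges of S this cycle
-- avoids S.

open import Defs
open import Data.Bool.Base using (true; false; if_then_else_; T)
open import Data.Bool.Properties using (T?; T-irrelevant; T-≡)
open import Data.Empty using (⊥; ⊥-elim)
open import Data.Fin.Base as Fin using (Fin; toℕ)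
import Data.Fin.Properties as Fin
import Data.Integer.Base as ℤ
import Data.Integer.Properties as ℤ
open import Data.List.Base using (List; []; _∷_; _++_; _∷ʳ_; map; length; foldl; reverse; filter; lookup; concat; concatMap; tabulate; allFin; upTo; cartesianProductWith)
open import Data.List.Extrema.Nat using (max; xs≤max; max≤v⁺; v≤max⁺)
open import Data.List.Properties using (++-assoc; ++-identityʳ; map-++; map-∘; map-cong; map-concatMap; map-tabulate; concatMap-cong; foldl-++; length-++; length-map; length-reverse; unfold-reverse)
import Data.List.Membership.DecPropositional as DecMembership
open import Data.List.Membership.Propositional using (_∈_; _∉_; lose)
open import Data.List.Membership.Propositional.Properties using (∈-++⁺ˡ; ∈-++⁺ʳ; ∈-++⁻; ∈-map⁺; ∈-map⁻; ∈-concatMap⁺; ∈-filter⁻; ∈-lookup; ∈-allFin; ∈-upTo⁺; ∈-cartesianProductWith⁺; ∈-cartesianProductWith⁻)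
open import Data.List.Relation.Binary.Disjoint.Propositional using (Disjoint)
open import Data.List.Relation.Unary.All as All using (All; []; _∷_)
import Data.List.Relation.Unary.All.Properties as All
open import Data.List.Relation.Unary.AllPairs as AllPairs using ([]; _∷_)
import Data.List.Relation.Unary.AllPairs.Properties as AllPairs
open import Data.List.Relation.Unary.Any as Any using (Any; here; there)
import Data.List.Relation.Unary.Any.Properties as Any
open import Data.List.Relation.Unary.Linked using (Linked; [-]; _∷_)
open import Data.List.Relation.Unary.Unique.Propositional using (Unique)
import Data.List.Relation.Unary.Unique.Propositional.Properties as Unique
open import Data.Nat.Base
open import Data.Nat.Properties
open import Data.Nat.Solver using (module +-*-Solver)
open import Data.Product.Base using (Σ-syntax; ∃-syntax; _×_; _,_; proj₁; proj₂)
import Data.Product.Properties as Product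
open import Data.Rational.Base as ℚ using (ℚ; 0ℚ; 1ℚ)
import Data.Rational.Properties as ℚ
open import Data.Rational.Unnormalised.Base as ℚᵘ using (mkℚᵘ; *≡*; *≤*)
import Data.Rational.Unnormalised.Properties as ℚᵘ
open import Data.Sum.Base using (_⊎_; inj₁; inj₂; [_,_]′)
open import Data.Unit.Base using (tt)
open import Function.Base using (_∘_; id)
open import Function.Bundles using (Equivalence)
open import Relation.Binary.PropositionalEquality hiding ([_])
open import Relation.Nullary using (¬_; Dec; yes; no; does)
open import Relation.Nullary.Decidable using (_⊎-dec_; ¬?; dec-true; dec-false)
open import Relation.Unary using (Decidable)

-- A program logic with time bounds

≡ᵇ-refl : ∀ k → (k ≡ᵇ k) ≡ true
≡ᵇ-refl zero    = refl
≡ᵇ-refl (suc k) = ≡ᵇ-refl k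

≢⇒≡ᵇ-false : ∀ {k l} → k ≢ l → (k ≡ᵇ l) ≡ false
≢⇒≡ᵇ-false {k} {l} k≢l with k ≡ᵇ l in eq
... | true  = ⊥-elim (k≢l (≡ᵇ⇒≡ k l (subst T (sym eq) tt)))
... | false = refl

<⇒<ᵇ-true : ∀ {k l} → k < l → (k <ᵇ l) ≡ true
<⇒<ᵇ-true {k} {l} k<l with k <ᵇ l in eq
... | true  = refl
... | false = ⊥-elim (subst T eq (<⇒<ᵇ k<l))

<ᵇ-irrefl : ∀ k → (k <ᵇ k) ≡ false
<ᵇ-irrefl zero    = refl
<ᵇ-irrefl (suc k) = <ᵇ-irrefl k

module _ {A : Set} (f : ℕ → ℕ → ℕ → A) (a : ℕ) where

  update-same : ∀ i j {x} → update f a i j x a i j ≡ x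
  update-same i j rewrite ≡ᵇ-refl a | ≡ᵇ-refl i | ≡ᵇ-refl j = refl

  update-otherRow : ∀ i j {x r} k → r ≢ i → update f a i j x a r k ≡ f a r k
  update-otherRow i j k r≢i rewrite ≡ᵇ-refl a | ≢⇒≡ᵇ-false (≢-sym r≢i) = refl

  update-otherColumn : ∀ i j k {x} → k ≢ j → update f a i j x a i k ≡ f a i k
  update-otherColumn i j k k≢j rewrite ≡ᵇ-refl a | ≡ᵇ-refl i | ≢⇒≡ᵇ-false (≢-sym k≢j) = refl

setI : Memory → ℕ → ℕ → ℕ → ℕ → Memory
setI m a i j x = record m { idx = update (idx m) a i j x }

setN : Memory → ℕ → ℕ → ℕ → ℚ → Memory
setN m a i j x = record m { num = update (num m) a i j x }

-- Total correctness with a time bound. The initial memory is a fixed index, not described by a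
-- precondition, so `Q` can refer to it.
record Exec (c : Program) (m : Memory) (bound : ℕ) (Q : Memory → Set) : Set where
  constructor exec
  field
    {final} : Memory
    {time}  : ℕ
    run     : Run c m final time
    time≤   : time ≤ bound
    post    : Q final

module _ {m : Memory} where

  weaken : ∀ {c b b′ Q R} → b ≤ b′ → (∀ m′ → Q m′ → R m′) → Exec c m b Q → Exec c m b′ R
  weaken b≤b′ Q⇒R (exec r τ≤ q) = exec r (≤-trans τ≤ b≤b′) (Q⇒R _ q)

  skipE : ∀ {Q} → Q m → Exec skip m 1 Q
  skipE q = exec skip ≤-refl q

  idxE : ∀ {a i j e Q} → Q (setI m a (evalI i m) (evalI j m) (evalI e m)) →
         Exec (idx a [ i , j ]≔ e) m (suc (timeI i + timeI j + timeI e)) Q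
  idxE q = exec idx≔ ≤-refl q

  numE : ∀ {a i j e Q} → Q (setN m a (evalI i m) (evalI j m) (evalN e m)) →
         Exec (num a [ i , j ]≔ e) m (suc (timeI i + timeI j + timeN e)) Q
  numE q = exec num≔ ≤-refl q

  seqE : ∀ {c₁ c₂ b₁ b₂ Q R} → Exec c₁ m b₁ Q → (∀ m′ → Q m′ → Exec c₂ m′ b₂ R) →
         Exec (c₁ ⨾ c₂) m (b₁ + b₂) R
  seqE (exec r₁ τ₁≤ q) k with k _ q
  ... | exec r₂ τ₂≤ q′ = exec (seq r₁ r₂) (+-mono-≤ τ₁≤ τ₂≤) q′

  ifteE : ∀ {g c₁ c₂ b Q} → (evalB g m ≡ true → Exec c₁ m b Q) →
          (evalB g m ≡ false → Exec c₂ m b Q) → Exec (ifte g c₁ c₂) m (suc (timeB g + b)) Q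
  ifteE {g} k₁ k₂ with evalB g m in eq
  ... | true  with k₁ refl
  ...   | exec r τ≤ q = exec (then′ eq r) (s≤s (+-monoʳ-≤ (timeB g) τ≤)) q
  ifteE {g} k₁ k₂ | false with k₂ refl
  ...   | exec r τ≤ q = exec (else′ eq r) (s≤s (+-monoʳ-≤ (timeB g) τ≤)) q

var : ℕ → IExp
var x = x [ lit 0 , lit 0 ]

for : ℕ → IExp → Program → Program
for x lim c = idx x [ lit 0 , lit 0 ]≔ lit 0 ⨾
              while (var x << lim) (c ⨾ idx x [ lit 0 , lit 0 ]≔ var x ⊕ lit 1)

-- A uniform bound: an iteration costs 13 + timeI lim besides its body, the
-- initialisation and the last test only 9 + timeI lim.
forTime : IExp → ℕ → ℕ → ℕ
forTime lim N b = N * (b + (13 + timeI lim)) + (13 + timeI lim)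

-- `lim` is evaluated anew at each test, so `limit` makes the invariant fix its value. `stable`
-- covers the writes to the counter by the loop itself; the body has to leave the counter as it
-- finds it.
module _ {x : ℕ} {lim : IExp} {c : Program} {b N : ℕ} (Inv : ℕ → Memory → Set)
  (stable : ∀ i m k → Inv i m → Inv i (setI m x 0 0 k))
  (limit  : ∀ i m → Inv i m → evalI lim m ≡ N)
  (body   : ∀ i m → i < N → idx m x 0 0 ≡ i → Inv i m →
            Exec c m b (λ m′ → idx m′ x 0 0 ≡ i × Inv (suc i) m′))
  where

  private
    -- Induction on the number `k` of iterations still to come; `5 + timeI lim` pays for the last,
    -- failing test.
    iterate : ∀ k {i m} → i + k ≡ N → idx m x 0 0 ≡ i → Inv i m →
              Exec (while (var x << lim) (c ⨾ idx x [ lit 0 , lit 0 ]≔ var x ⊕ lit 1)) m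
                   (k * (b + (13 + timeI lim)) + (5 + timeI lim)) (Inv N)
    iterate zero {i} {m} i+0≡N x≡i inv =
      exec (stop guard) ≤-refl (subst (λ j → Inv j m) i≡N inv)
      where
      i≡N : i ≡ N
      i≡N = trans (sym (+-identityʳ i)) i+0≡N
      guard : (idx m x 0 0 <ᵇ evalI lim m) ≡ false
      guard rewrite x≡i | limit i m inv | i≡N = <ᵇ-irrefl N
    iterate (suc k) {i} {m} i+k≡N x≡i inv
      with body i m (m+n≤o⇒m≤o (suc i) (≤-reflexive (trans (sym (+-suc i k)) i+k≡N))) x≡i inv
    ... | exec {m₁} {τ₁} r₁ τ₁≤ (x≡i′ , inv′)
      with iterate k {suc i} {setI m₁ x 0 0 (idx m₁ x 0 0 + 1)}
                   (trans (sym (+-suc i k)) i+k≡N)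
                   (trans (update-same (idx m₁) x 0 0) (trans (+-comm _ 1) (cong suc x≡i′)))
                   (stable (suc i) m₁ _ inv′)
    ... | exec {m₂} {τ₂} r₂ τ₂≤ q = exec (loop guard (seq r₁ idx≔) r₂) time q
      where
      L = timeI lim
      guard : (idx m x 0 0 <ᵇ evalI lim m) ≡ true
      guard rewrite x≡i | limit i m inv =
        <⇒<ᵇ-true (m+n≤o⇒m≤o (suc i) (≤-reflexive (trans (sym (+-suc i k)) i+k≡N)))
      time : suc (suc (3 + L) + (τ₁ + 8) + τ₂) ≤ suc k * (b + (13 + L)) + (5 + L)
      time = begin
        5 + L + (τ₁ + 8) + τ₂                    ≤⟨ +-mono-≤ (+-monoʳ-≤ (5 + L) (+-monoˡ-≤ 8 τ₁≤)) τ₂≤ ⟩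
        5 + L + (b + 8) + (k * (b + (13 + L)) + (5 + L)) ≡⟨ +-assoc (5 + L + (b + 8)) _ _ ⟨
        5 + L + (b + 8) + k * (b + (13 + L)) + (5 + L)   ≡⟨ cong (λ z → z + k * (b + (13 + L)) + (5 + L)) shuffle ⟩
        suc k * (b + (13 + L)) + (5 + L)         ∎
        where
        open ≤-Reasoning
        shuffle : 5 + L + (b + 8) ≡ b + (13 + L)
        shuffle = trans (+-comm (5 + L) (b + 8)) (+-assoc b 8 (5 + L))

  forE : ∀ {m} → Inv 0 m → Exec (for x lim c) m (forTime lim N b) (Inv N)
  forE {m} inv with iterate N {0} {setI m x 0 0 0} refl (update-same (idx m) x 0 0) (stable 0 m 0 inv)
  ... | exec r τ≤ q = exec (seq idx≔ r) time q
    where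
    open ≤-Reasoning
    L = timeI lim
    time : 4 + _ ≤ forTime lim N b
    time = begin
      4 + _                                   ≤⟨ +-monoʳ-≤ 4 τ≤ ⟩
      4 + (N * (b + (13 + L)) + (5 + L))      ≡⟨ +-assoc 4 (N * (b + (13 + L))) (5 + L) ⟨
      4 + N * (b + (13 + L)) + (5 + L)        ≡⟨ cong (_+ (5 + L)) (+-comm 4 (N * (b + (13 + L)))) ⟩
      N * (b + (13 + L)) + 4 + (5 + L)        ≡⟨ +-assoc (N * (b + (13 + L))) 4 (5 + L) ⟩
      N * (b + (13 + L)) + (9 + L)            ≤⟨ +-monoʳ-≤ (N * (b + (13 + L))) (+-monoˡ-≤ L (m≤m+n 9 4)) ⟩
      N * (b + (13 + L)) + (13 + L)           ∎

-- The algorithm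

-- Grows at the right end, in the order in which a loop writes, so that one iteration adds exactly
-- the last block.
catTo : {A : Set} → (ℕ → List A) → ℕ → List A
catTo f zero    = []
catTo f (suc k) = catTo f k ++ f k

readTo : {A : Set} → (ℕ → A) → ℕ → List A
readTo f = catTo (λ i → f i ∷ [])

catTo-cong : {A : Set} {f g : ℕ → List A} (k : ℕ) → (∀ i → i < k → f i ≡ g i) → catTo f k ≡ catTo g k
catTo-cong zero    f≈g = refl
catTo-cong (suc k) f≈g = cong₂ _++_ (catTo-cong k (λ i i<k → f≈g i (m<n⇒m<1+n i<k))) (f≈g k ≤-refl)

readTo-cong : {A : Set} {f g : ℕ → A} (k : ℕ) → (∀ i → i < k → f i ≡ g i) → readTo f k ≡ readTo g k
readTo-cong k f≈g = catTo-cong k (λ i i<k → cong (_∷ []) (f≈g i i<k))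

length-readTo : {A : Set} (f : ℕ → A) (k : ℕ) → length (readTo f k) ≡ k
length-readTo f zero    = refl
length-readTo f (suc k) = trans (length-++ (readTo f k)) (trans (cong (_+ 1) (length-readTo f k)) (+-comm k 1))

∈-readTo : {A : Set} (f : ℕ → A) {i k : ℕ} → i < k → f i ∈ readTo f k
∈-readTo f {i} {suc k} i<1+k with m<1+n⇒m<n∨m≡n i<1+k
... | inj₁ i<k  = ∈-++⁺ˡ (∈-readTo f i<k)
... | inj₂ refl = ∈-++⁺ʳ (readTo f k) (here refl)

Any⇒0<length : {A : Set} {P : A → Set} {xs : List A} → Any P xs → 0 < length xs
Any⇒0<length {xs = _ ∷ _} _ = s≤s z≤n

sumℚ-∷ʳ : ∀ xs x → sumℚ (xs ++ x ∷ []) ≡ sumℚ xs ℚ.+ x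
sumℚ-∷ʳ []       x = ℚ.+-comm x 0ℚ
sumℚ-∷ʳ (y ∷ xs) x = trans (cong (y ℚ.+_) (sumℚ-∷ʳ xs x)) (sym (ℚ.+-assoc y (sumℚ xs) x))

≤ᵇ-true⇒≤ : ∀ {x y} → (x ℚ.≤ᵇ y) ≡ true → x ℚ.≤ y
≤ᵇ-true⇒≤ eq = ℚ.≤ᵇ⇒≤ (subst T (sym eq) tt)

≤ᵇ-false⇒≥ : ∀ {x y} → (x ℚ.≤ᵇ y) ≡ false → y ℚ.≤ x
≤ᵇ-false⇒≥ {x} {y} eq with ℚ.≤-total x y
... | inj₁ x≤y = ⊥-elim (subst T eq (ℚ.≤⇒≤ᵇ x≤y))
... | inj₂ y≤x = y≤x

-- The accumulator never falls below `D`; the disjunction records that `D` has been reached already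
-- or is still to come, and once reached it stays.
foldl-⊓ : {A : Set} {f : A → ℚ} {D a : ℚ} {xs : List A} → D ℚ.≤ a → All (λ x → D ℚ.≤ f x) xs →
          a ≡ D ⊎ Any (λ x → f x ≡ D) xs → foldl (λ d x → f x ℚ.⊓ d) a xs ≡ D
foldl-⊓ D≤a []           (inj₁ a≡D)          = a≡D
foldl-⊓ D≤a (D≤x ∷ D≤xs) (inj₁ refl)         = foldl-⊓ (ℚ.⊓-glb D≤x D≤a) D≤xs (inj₁ (ℚ.p≥q⇒p⊓q≡q D≤x))
foldl-⊓ D≤a (D≤x ∷ D≤xs) (inj₂ (here refl))  = foldl-⊓ (ℚ.⊓-glb D≤x D≤a) D≤xs (inj₁ (ℚ.p≤q⇒p⊓q≡p D≤a))
foldl-⊓ D≤a (D≤x ∷ D≤xs) (inj₂ (there D∈xs)) = foldl-⊓ (ℚ.⊓-glb D≤x D≤a) D≤xs (inj₂ D∈xs)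

-- The probability and the cost of a path.
Entry : Set
Entry = ℚ × ℚ

entry : Memory → ℕ → ℕ → Entry
entry m r i = num m 5 r i , num m 4 r i

-- Rows of the table in memory

Row : Memory → ℕ → List Entry → Set
Row m r L = readTo (entry m r) (idx m 4 r 0) ≡ L

Row-length : ∀ {m r L} → Row m r L → idx m 4 r 0 ≡ length L
Row-length {m} {r} row = trans (sym (length-readTo (entry m r) _)) (cong length row)

-- The frame condition for a write to row `R`: all that a `Row` statement reads is the length in
-- column `0` and the entries.
record AgreeOff (R : ℕ) (m m′ : Memory) : Set where
  field
    len-eq   : ∀ r → r ≢ R → idx m′ 4 r 0 ≡ idx m 4 r 0
    entry-eq : ∀ r i → r ≢ R → entry m′ r i ≡ entry m r i

Row-off : ∀ {R m m′ r L} → AgreeOff R m m′ → r ≢ R → Row m r L → Row m′ r L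
Row-off {m = m} {m′} {r} off r≢R row
  rewrite AgreeOff.len-eq off r r≢R =
  trans (readTo-cong (idx m 4 r 0) (λ i _ → AgreeOff.entry-eq off r i r≢R)) row

-- Memory layout: the list for vertex v and step bound k - 1 is row r = k * n + v,
-- of length idx 4 [ r , 0 ], with costs in num 4 and probabilities in num 5.
-- Row k * n + n + v is computed while idx 5 holds k * n; idx 6 to idx 9 count
-- levels, vertices v, successors u of v, and entries of a row.  Finally num 6
-- receives d(s,t) and num 7 the probability.
current previous : IExp
current  = var 5 ⊕ var 0 ⊕ var 7
previous = var 5 ⊕ var 8

-- The length is raised last, because both stores use the old length as the column of the new entry.
append : NExp → NExp → Program
append c q = num 4 [ current , 4 [ current , lit 0 ] ]≔ c ⨾
             num 5 [ current , 4 [ current , lit 0 ] ]≔ q ⨾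
             idx 4 [ current , lit 0 ]≔ 4 [ current , lit 0 ] ⊕ lit 1

reset : Program
reset = idx 4 [ current , lit 0 ]≔ lit 0

appended : Memory → ℕ → Entry → Memory
appended m r (q , c) =
  setI (setN (setN m 4 r (idx m 4 r 0) c) 5 r (idx m 4 r 0) q) 4 r 0 (idx m 4 r 0 + 1)

appended-off : ∀ m r x → AgreeOff r m (appended m r x)
appended-off m r x = record
  { len-eq   = λ r′ r′≢r → update-otherRow (idx m) 4 r 0 0 r′≢r
  ; entry-eq = λ r′ i r′≢r → cong₂ _,_ (update-otherRow (num m) 5 r (idx m 4 r 0) i r′≢r)
                                     (update-otherRow (num m) 4 r (idx m 4 r 0) i r′≢r)
  }

appended-row : ∀ m r x {L} → Row m r L → Row (appended m r x) r (L ++ x ∷ [])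
appended-row m r x@(q , c) {L} row = begin
  readTo (entry m′ r) (idx m′ 4 r 0)                   ≡⟨ cong (readTo (entry m′ r)) (trans (update-same (idx m) 4 r 0) (+-comm l 1)) ⟩
  readTo (entry m′ r) l ++ entry m′ r l ∷ []           ≡⟨ cong₂ (λ K y → K ++ y ∷ []) old new ⟩
  L ++ x ∷ []                                          ∎
  where
  open ≡-Reasoning
  l  = idx m 4 r 0
  m′ = appended m r x
  new : entry m′ r l ≡ x
  new = cong₂ _,_ (update-same (num m) 5 r l) (update-same (num m) 4 r l)
  old : readTo (entry m′ r) l ≡ L
  old = trans (readTo-cong l (λ i i<l → cong₂ _,_ (update-otherColumn (num m) 5 r l i (<⇒≢ i<l))
                                                 (update-otherColumn (num m) 4 r l i (<⇒≢ i<l)))) row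

reset-off : ∀ m r → AgreeOff r m (setI m 4 r 0 0)
reset-off m r = record
  { len-eq   = λ r′ r′≢r → update-otherRow (idx m) 4 r 0 0 r′≢r
  ; entry-eq = λ r′ i r′≢r → refl
  }

reset-row : ∀ m r → Row (setI m 4 r 0 0) r []
reset-row m r rewrite update-same (idx m) 4 r 0 {0} = refl

appendTime : NExp → NExp → ℕ
appendTime c q = suc (timeI current + (9 + 4) + timeN c) +
  (suc (timeI current + (9 + 4) + timeN q) + suc (timeI current + 1 + (14 + 1)))

-- The program and its time constants

newCost newProb : NExp
newCost = 2 [ var 7 , var 8 ] ⊕ 4 [ previous , var 9 ]
newProb = 3 [ var 7 , var 8 ] ⊗ 5 [ previous , var 9 ]

entryLoop : Program
entryLoop = for 9 (4 [ previous , lit 0 ]) (append newCost newProb)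

entryTime : ℕ
entryTime = appendTime newCost newProb

isArc : BExp
isArc = 3 [ var 7 , var 8 ] == lit 1

arcBody : Program
arcBody = ifte isArc entryLoop skip

-- `22` is `13 + timeI lim` for the limit of `entryLoop`, counted once per iteration and once for
-- the loop. From here on the times are per unit of row length: the actual bounds are `B` times as
-- large, where `B` bounds the length of every row.
arcTime : ℕ
arcTime = suc (timeB isArc) + (entryTime + 22 + 22)

isTarget : BExp
isTarget = var 7 == var 2

vertexBody : Program
vertexBody = reset ⨾ ifte isTarget (append (lit 0ℚ) (lit 1ℚ)) (for 8 (var 0) arcBody)

targetTime resetTime : ℕ
targetTime = appendTime (lit 0ℚ) (lit 1ℚ)
resetTime  = suc (timeI current + 1 + 1)

vertexTime : ℕ → ℕ
vertexTime n = resetTime + (suc (timeB isTarget) + (targetTime + forTime (var 0) n arcTime))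

levelBody : Program
levelBody = for 7 (var 0) vertexBody ⨾ idx 5 [ lit 0 , lit 0 ]≔ var 5 ⊕ var 0

levelTime : ℕ → ℕ
levelTime n = forTime (var 0) n (vertexTime n) + 10

-- Level `k` belongs to step bound `k - 1`, so step bound `n` is reached after `n + 1` rounds. Then
-- `idx 5` holds `suc n * n`, and `startRow` is the row of `s` in the last level.
levels : Program
levels = for 6 (var 0 ⊕ lit 1) levelBody

startRow : IExp
startRow = var 5 ⊕ var 1

scan : Program → Program
scan = for 9 (4 [ startRow , lit 0 ])

isShorter withinBudget : BExp
isShorter    = 4 [ startRow , var 9 ] ≼ 6 [ lit 0 , lit 0 ]
-- The condition `X ≤ W` multiplied by `d(s,t)`, since numbers admit no division.
withinBudget = 4 [ startRow , var 9 ] ≼ 0 [ lit 0 , lit 0 ] ⊗ 6 [ lit 0 , lit 0 ]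

findDistance sumProbabilities : Program
findDistance =
  num 6 [ lit 0 , lit 0 ]≔ 4 [ startRow , lit 0 ] ⨾
  scan (ifte isShorter (num 6 [ lit 0 , lit 0 ]≔ 4 [ startRow , var 9 ]) skip)
sumProbabilities =
  num 7 [ lit 0 , lit 0 ]≔ lit 0ℚ ⨾
  scan (ifte withinBudget
          (num 7 [ lit 0 , lit 0 ]≔ 7 [ lit 0 , lit 0 ] ⊕ 5 [ startRow , var 9 ]) skip)

eci : Program
eci = levels ⨾ findDistance ⨾ sumProbabilities ⨾ num 0 [ lit 0 , lit 0 ]≔ 7 [ lit 0 , lit 0 ]

-- `86` is paid for each of the two scans of the start row and `6` for the output, again up to the
-- factor `B`.
eciTime : ℕ → ℕ
eciTime n = forTime (var 0 ⊕ lit 1) (suc n) (levelTime n) + (86 + (86 + 6))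

-- Correctness and running time of the loops

module Table (n s t : ℕ) (adj : ℕ → ℕ → ℕ) (W : ℚ) (w p : ℕ → ℕ → ℚ) where

  extend : ℕ → ℕ → Entry → Entry
  extend v u (q , c) = p v u ℚ.* q , w v u ℚ.+ c

  branch : (ℕ → List Entry) → ℕ → ℕ → List Entry
  branch L v u = if adj v u ≡ᵇ 1 then map (extend v u) (L u) else []

  -- Shifted by one against the step bound of `traversal`: level `0` is empty even at `t`, which
  -- matches the zero lengths in the initial memory.
  table : ℕ → ℕ → List Entry
  table zero    v = []
  table (suc k) v = if v ≡ᵇ t then (1ℚ , 0ℚ) ∷ [] else catTo (branch (table k) v) n

  -- The parameters are the arrays themselves, so that writing to any other
  -- array preserves Input definitionally.
  record Input′ (n₀ s₀ t₀ : ℕ) (adj₀ : ℕ → ℕ → ℕ) (W₀ : ℚ) (w₀ p₀ : ℕ → ℕ → ℚ) : Set where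
    field
      n-eq   : n₀ ≡ n
      s-eq   : s₀ ≡ s
      t-eq   : t₀ ≡ t
      adj-eq : ∀ u v → adj₀ u v ≡ adj u v
      W-eq   : W₀ ≡ W
      w-eq   : ∀ u v → w₀ u v ≡ w u v
      p-eq   : ∀ u v → p₀ u v ≡ p u v
  open Input′

  Input : Memory → Set
  Input m = Input′ (idx m 0 0 0) (idx m 1 0 0) (idx m 2 0 0) (idx m 3) (num m 0 0 0) (num m 2) (num m 3)

  -- Only the rows of level `k` are kept, for the next level reads no others.
  LevelInv : ℕ → Memory → Set
  LevelInv k m = Input m × idx m 5 0 0 ≡ k * n × (∀ u → u < n → Row m (k * n + u) (table k u))

  VertexInv : ℕ → ℕ → Memory → Set
  VertexInv k v m = LevelInv k m × idx m 6 0 0 ≡ k × (∀ u → u < v → Row m (k * n + n + u) (table (suc k) u))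

  ArcInv : ℕ → ℕ → ℕ → Memory → Set
  ArcInv k v u m = VertexInv k v m × idx m 7 0 0 ≡ v ×
                   Row m (k * n + n + v) (catTo (branch (table k) v) u)

  -- The row being read is pinned to a fixed function `g` and length `l`, so its contents stay known
  -- while the current row grows.
  EntryInv : ℕ → ℕ → ℕ → (ℕ → Entry) → ℕ → ℕ → Memory → Set
  EntryInv k v u g l i m = VertexInv k v m × idx m 7 0 0 ≡ v × idx m 8 0 0 ≡ u ×
    idx m 4 (k * n + u) 0 ≡ l × (∀ j → entry m (k * n + u) j ≡ g j) ×
    Row m (k * n + n + v) (catTo (branch (table k) v) u ++ map (extend v u) (readTo g i))

  -- The rows read lie in the block of `n` rows from `k * n` on, the rows written lie beyond that
  -- block.
  previous≢current : ∀ {k u v} → u < n → k * n + u ≢ k * n + n + v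
  previous≢current {k} {u} {v} u<n =
    <⇒≢ (<-≤-trans (+-monoʳ-< (k * n) u<n) (m≤m+n (k * n + n) v))

  VertexInv-off : ∀ k v m m′ → Input m′ → idx m′ 5 0 0 ≡ idx m 5 0 0 → idx m′ 6 0 0 ≡ idx m 6 0 0 →
                  AgreeOff (k * n + n + v) m m′ → VertexInv k v m → VertexInv k v m′
  VertexInv-off k v m m′ inp eq₅ eq₆ off ((_ , b , rows) , k-eq , new) =
    (inp , trans eq₅ b , λ u u<n → Row-off off (previous≢current {k} u<n) (rows u u<n)) ,
    trans eq₆ k-eq , λ u u<v → Row-off off (<⇒≢ (+-monoʳ-< (k * n + n) u<v)) (new u u<v)

  current-eq : ∀ k v m → VertexInv k v m → idx m 7 0 0 ≡ v → evalI current m ≡ k * n + n + v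
  current-eq k v m ((inp , b , _) , _) v-eq = cong₂ _+_ (cong₂ _+_ b (n-eq inp)) v-eq

  -- `prob` is evaluated after the cost has been stored, hence in the memory that contains this
  -- write.
  appendE : ∀ {m r cost prob x Q} → evalI current m ≡ r → evalN cost m ≡ proj₂ x →
            evalN prob (setN m 4 r (idx m 4 r 0) (proj₂ x)) ≡ proj₁ x →
            Q (appended m r x) →
            Exec (append cost prob) m (appendTime cost prob) Q
  appendE {m} {cost = cost} {prob} {x} refl refl refl q =
    seqE (numE {Q = λ m′ → m′ ≡ m₁} refl) λ { _ refl →
    seqE (numE {Q = λ m′ → m′ ≡ setN m₁ 5 r (idx m 4 r 0) (evalN prob m₁)} refl) λ { _ refl → idxE q } }
    where
    r = evalI current m
    m₁ = setN m 4 r (idx m 4 r 0) (evalN cost m)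

  entryE : ∀ {k v u l m} (g : ℕ → Entry) → u < n → EntryInv k v u g l 0 m →
           Exec entryLoop m (forTime (4 [ previous , lit 0 ]) l entryTime) (EntryInv k v u g l l)
  entryE {k} {v} {u} {l} g u<n = forE (EntryInv k v u g l) (λ _ _ _ inv → inv) limit body
    where
    R = k * n + n + v
    limit : ∀ i m → EntryInv k v u g l i m → evalI (4 [ previous , lit 0 ]) m ≡ l
    limit i m (((_ , b , _) , _) , _ , u-eq , l-eq , _) =
      trans (cong (λ r → idx m 4 r 0) (cong₂ _+_ b u-eq)) l-eq
    body : ∀ i m → i < l → idx m 9 0 0 ≡ i → EntryInv k v u g l i m →
           Exec (append newCost newProb) m entryTime
                (λ m′ → idx m′ 9 0 0 ≡ i × EntryInv k v u g l (suc i) m′)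
    body i m i<l i-eq (vi@((inp , b , _) , _) , v-eq , u-eq , l-eq , g-eq , row) =
      appendE {x = x} (current-eq k v m vi v-eq) cost-eq prob-eq
        (i-eq , VertexInv-off k v m _ inp refl refl off vi , v-eq , u-eq ,
         trans (AgreeOff.len-eq off _ (previous≢current {k} u<n)) l-eq ,
         (λ j → trans (AgreeOff.entry-eq off _ j (previous≢current {k} u<n)) (g-eq j)) ,
         subst (Row (appended m R x) R) list-eq (appended-row m R x row))
      where
      x = extend v u (g i)
      off = appended-off m R x
      cost-eq : evalN newCost m ≡ proj₂ x
      cost-eq rewrite v-eq | u-eq | i-eq | b =
        cong₂ ℚ._+_ (w-eq inp v u) (cong proj₂ (g-eq i))
      prob-eq : evalN newProb (setN m 4 R (idx m 4 R 0) (proj₂ x)) ≡ proj₁ x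
      prob-eq rewrite v-eq | u-eq | i-eq | b =
        cong₂ ℚ._*_ (p-eq inp v u) (cong proj₁ (g-eq i))
      pre = catTo (branch (table k) v) u
      list-eq : (pre ++ map (extend v u) (readTo g i)) ++ x ∷ [] ≡ pre ++ map (extend v u) (readTo g (suc i))
      list-eq = trans (++-assoc pre _ _) (cong (pre ++_) (sym (map-++ (extend v u) (readTo g i) _)))

  module Bounded (B : ℕ) (1≤B : 1 ≤ B)
    (short : ∀ k u → k ≤ suc n → u < n → length (table k u) ≤ B) where

    -- `1 ≤ B` absorbs the steps taken outside the loops over rows, so that every bound can be
    -- brought to the form `B * x`.
    scale : ∀ x → x ≤ B * x
    scale x = ≤-trans (≤-reflexive (sym (*-identityˡ x))) (*-monoˡ-≤ x 1≤B)

    scale-+ : ∀ a x → a + B * x ≤ B * (a + x)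
    scale-+ a x = ≤-trans (+-monoˡ-≤ (B * x) (scale a)) (≤-reflexive (sym (*-distribˡ-+ B a x)))

    scale-seq : ∀ x {y z} → y ≤ B * z → B * x + y ≤ B * (x + z)
    scale-seq x {z = z} y≤Bz = ≤-trans (+-monoʳ-≤ (B * x) y≤Bz) (≤-reflexive (sym (*-distribˡ-+ B x z)))

    -- For the loops over levels, vertices and successors: the factor `B` comes from the body and is
    -- moved outside.
    scale-forTime : ∀ lim N x → forTime lim N (B * x) ≤ B * forTime lim N x
    scale-forTime lim N x = begin
      N * (B * x + K) + K        ≤⟨ +-mono-≤ (*-monoʳ-≤ N (≤-trans (+-monoʳ-≤ (B * x) (scale K)) (≤-reflexive (sym (*-distribˡ-+ B x K))))) (scale K) ⟩
      N * (B * (x + K)) + B * K  ≡⟨ cong (_+ B * K) (trans (sym (*-assoc N B _)) (trans (cong (_* (x + K)) (*-comm N B)) (*-assoc B N _))) ⟩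
      B * (N * (x + K)) + B * K  ≡⟨ *-distribˡ-+ B (N * (x + K)) K ⟨
      B * (N * (x + K) + K)      ∎
      where
      open ≤-Reasoning
      K = 13 + timeI lim

    -- For the loops over a row: here `B` arises, as a bound on the number of iterations.
    forTime-short : ∀ lim {l} b → l ≤ B → forTime lim l b ≤ B * (b + (13 + timeI lim) + (13 + timeI lim))
    forTime-short lim {l} b l≤B = begin
      l * (b + K) + K      ≤⟨ +-mono-≤ (*-monoˡ-≤ (b + K) l≤B) (scale K) ⟩
      B * (b + K) + B * K  ≡⟨ *-distribˡ-+ B (b + K) K ⟨
      B * (b + K + K)      ∎
      where
      open ≤-Reasoning
      K = 13 + timeI lim

    arcE : ∀ {k v m} → k ≤ n → ArcInv k v 0 m →
           Exec (for 8 (var 0) arcBody) m (B * forTime (var 0) n arcTime) (ArcInv k v n)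
    arcE {k} {v} k≤n inv₀ = weaken (scale-forTime (var 0) n arcTime) (λ _ inv → inv)
      (forE (ArcInv k v) (λ _ _ _ inv → inv) (λ _ _ (((inp , _) , _) , _) → n-eq inp) body inv₀)
      where
      R = k * n + n + v
      body : ∀ u m → u < n → idx m 8 0 0 ≡ u → ArcInv k v u m →
             Exec arcBody m (B * arcTime) (λ m′ → idx m′ 8 0 0 ≡ u × ArcInv k v (suc u) m′)
      body u m u<n u-eq (vi@((inp , b , rows) , _) , v-eq , row) =
        weaken (scale-+ (suc (timeB isArc)) (entryTime + 22 + 22)) (λ _ q → q) (ifteE yes′ no′)
        where
        g = entry m (k * n + u)
        pre = catTo (branch (table k) v) u
        len-eq : idx m 4 (k * n + u) 0 ≡ length (table k u)
        len-eq = Row-length {m} (rows u u<n)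
        test-eq : evalB isArc m ≡ (adj v u ≡ᵇ 1)
        test-eq rewrite v-eq | u-eq = cong (_≡ᵇ 1) (adj-eq inp v u)
        read-eq : readTo g (length (table k u)) ≡ table k u
        read-eq = trans (cong (readTo g) (sym len-eq)) (rows u u<n)
        yes′ : evalB isArc m ≡ true → Exec entryLoop m (B * (entryTime + 22 + 22))
                 (λ m′ → idx m′ 8 0 0 ≡ u × ArcInv k v (suc u) m′)
        yes′ true-eq =
          weaken (forTime-short (4 [ previous , lit 0 ]) entryTime (short k u (m≤n⇒m≤1+n k≤n) u<n))
            (λ { m′ (vi′ , v-eq′ , u-eq′ , _ , _ , row′) → u-eq′ , vi′ , v-eq′ , trans row′ done })
            (entryE {l = length (table k u)} g u<n
              (vi , v-eq , u-eq , len-eq , (λ _ → refl) , trans row (sym (++-identityʳ pre))))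
          where
          done : pre ++ map (extend v u) (readTo g (length (table k u))) ≡ pre ++ branch (table k) v u
          done rewrite read-eq | trans (sym test-eq) true-eq = refl
        no′ : evalB isArc m ≡ false → Exec skip m (B * (entryTime + 22 + 22))
                (λ m′ → idx m′ 8 0 0 ≡ u × ArcInv k v (suc u) m′)
        no′ false-eq = weaken (≤-trans (s≤s z≤n) (scale (entryTime + 22 + 22))) (λ _ q → q)
          (skipE (u-eq , vi , v-eq , trans row done))
          where
          done : pre ≡ pre ++ branch (table k) v u
          done rewrite trans (sym test-eq) false-eq = sym (++-identityʳ pre)

    vertexE : ∀ {k m} → k ≤ n → VertexInv k 0 m →
              Exec (for 7 (var 0) vertexBody) m (B * forTime (var 0) n (vertexTime n)) (VertexInv k n)
    vertexE {k} k≤n inv₀ = weaken (scale-forTime (var 0) n (vertexTime n)) (λ _ inv → inv)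
      (forE (VertexInv k) (λ _ _ _ inv → inv) (λ _ _ ((inp , _) , _) → n-eq inp) body inv₀)
      where
      inner : ℕ
      inner = targetTime + forTime (var 0) n arcTime

      snoc : ∀ v m → VertexInv k v m → Row m (k * n + n + v) (table (suc k) v) → VertexInv k (suc v) m
      snoc v m (li , k-eq , new) row = li , k-eq , λ u u<1+v → case u (m<1+n⇒m<n∨m≡n u<1+v)
        where
        case : ∀ u → u < v ⊎ u ≡ v → Row m (k * n + n + u) (table (suc k) u)
        case u (inj₁ u<v)  = new u u<v
        case u (inj₂ refl) = row

      body : ∀ v m → v < n → idx m 7 0 0 ≡ v → VertexInv k v m →
             Exec vertexBody m (B * vertexTime n) (λ m′ → idx m′ 7 0 0 ≡ v × VertexInv k (suc v) m′)
      body v m v<n v-eq vi@((inp , b , rows) , _) =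
        weaken (scale-+ resetTime (suc (timeB isTarget) + inner)) (λ _ q → q)
          (seqE (idxE {Q = Start} (subst (λ r → Start (setI m 4 r 0 0)) (sym (current-eq k v m vi v-eq))
                   (VertexInv-off k v m _ inp refl refl (reset-off m R) vi , v-eq , reset-row m R)))
            λ m′ start → weaken (scale-+ (suc (timeB isTarget)) inner) (λ _ q → q) (choose start))
        where
        R = k * n + n + v
        Start : Memory → Set
        Start = ArcInv k v 0
        Done : Memory → Set
        Done m′ = idx m′ 7 0 0 ≡ v × VertexInv k (suc v) m′
        choose : ∀ {m′} → Start m′ → Exec (ifte isTarget (append (lit 0ℚ) (lit 1ℚ)) (for 8 (var 0) arcBody)) m′
                   (suc (timeB isTarget + B * inner)) Done
        choose {m′} start@(vi′@((inp′ , _) , _) , v-eq′ , row′) = ifteE yes′ no′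
          where
          test-eq : evalB isTarget m′ ≡ (v ≡ᵇ t)
          test-eq = cong₂ _≡ᵇ_ v-eq′ (t-eq inp′)
          yes′ : evalB isTarget m′ ≡ true → Exec (append (lit 0ℚ) (lit 1ℚ)) m′ (B * inner) Done
          yes′ true-eq = weaken (≤-trans (m≤m+n targetTime _) (scale inner)) (λ _ q → q)
            (appendE {x = 1ℚ , 0ℚ} (current-eq k v m′ vi′ v-eq′) refl refl
              (v-eq′ , snoc v (appended m′ R (1ℚ , 0ℚ)) (VertexInv-off k v m′ _ inp′ refl refl (appended-off m′ R (1ℚ , 0ℚ)) vi′)
                            (trans (appended-row m′ R (1ℚ , 0ℚ) row′) done)))
            where
            done : (1ℚ , 0ℚ) ∷ [] ≡ table (suc k) v
            done rewrite trans (sym test-eq) true-eq = refl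
          no′ : evalB isTarget m′ ≡ false → Exec (for 8 (var 0) arcBody) m′ (B * inner) Done
          no′ false-eq = weaken (*-monoʳ-≤ B (m≤n+m _ targetTime))
            (λ { m″ (vi″ , v-eq″ , row″) → v-eq″ , snoc v m″ vi″ (trans row″ done) }) (arcE k≤n start)
            where
            done : catTo (branch (table k) v) n ≡ table (suc k) v
            done rewrite trans (sym test-eq) false-eq = refl

    levelsE : ∀ {m} → LevelInv 0 m →
              Exec levels m (B * forTime (var 0 ⊕ lit 1) (suc n) (levelTime n)) (LevelInv (suc n))
    levelsE inv₀ = weaken (scale-forTime (var 0 ⊕ lit 1) (suc n) (levelTime n)) (λ _ inv → inv)
      (forE LevelInv (λ _ _ _ inv → inv)
        (λ _ _ (inp , _) → trans (cong (_+ 1) (n-eq inp)) (+-comm n 1)) body inv₀)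
      where
      body : ∀ k m → k < suc n → idx m 6 0 0 ≡ k → LevelInv k m →
             Exec levelBody m (B * levelTime n) (λ m′ → idx m′ 6 0 0 ≡ k × LevelInv (suc k) m′)
      body k m (s≤s k≤n) k-eq li =
        weaken (scale-seq (forTime (var 0) n (vertexTime n)) (scale 10)) (λ _ q → q)
          (seqE (vertexE k≤n (li , k-eq , λ _ ()))
            -- Advancing `idx 5` by `n` makes the block just written the one to be read, as
            -- `k * n + n` equals `suc k * n`.
            λ { m′ ((inp , b , _) , k-eq′ , new) → idxE (k-eq′ ,
              inp , trans (cong₂ _+_ b (n-eq inp)) (+-comm (k * n) n) ,
              λ u u<n → subst (λ r → Row m′ r (table (suc k) u)) (cong (_+ u) (+-comm (k * n) n)) (new u u<n)) })

    -- Distance and probability from the row of the start vertex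

    module Final (D : ℚ) (D≤ : All (λ x → D ℚ.≤ proj₂ x) (table (suc n) s))
      (D∈ : Any (λ x → proj₂ x ≡ D) (table (suc n) s)) (s<n : s < n) where

      paths : List Entry
      paths = table (suc n) s

      l : ℕ
      l = length paths

      r : ℕ
      r = suc n * n + s

      contribution : Entry → ℚ
      contribution (q , c) = if c ℚ.≤ᵇ W ℚ.* D then q else 0ℚ

      module _ (g : ℕ → Entry) (g-reads : readTo g l ≡ paths) where

        ScanInv MinInv₀ : Memory → Set
        ScanInv m = Input m × idx m 5 0 0 ≡ suc n * n × idx m 4 r 0 ≡ l × (∀ j → entry m r j ≡ g j)
        MinInv₀ m = ScanInv m × num m 6 0 0 ≡ D

        MinInv SumInv : ℕ → Memory → Set
        MinInv i m = ScanInv m × num m 6 0 0 ≡ foldl (λ d x → proj₂ x ℚ.⊓ d) (proj₂ (g 0)) (readTo g i)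
        SumInv i m = MinInv₀ m × num m 7 0 0 ≡ sumℚ (map contribution (readTo g i))

        row-eq : ∀ m → ScanInv m → evalI startRow m ≡ r
        row-eq m (inp , b , _) = cong₂ _+_ b (s-eq inp)

        scan-limit : ∀ m → ScanInv m → evalI (4 [ startRow , lit 0 ]) m ≡ l
        scan-limit m inv@(_ , _ , l-eq , _) = trans (cong (λ x → idx m 4 x 0) (row-eq m inv)) l-eq

        read-cost : ∀ i m → ScanInv m → idx m 9 0 0 ≡ i → evalN (4 [ startRow , var 9 ]) m ≡ proj₂ (g i)
        read-cost i m inv@(_ , _ , _ , g-eq) i-eq =
          trans (cong₂ (num m 4) (row-eq m inv) i-eq) (cong proj₂ (g-eq i))

        read-prob : ∀ i m → ScanInv m → idx m 9 0 0 ≡ i → evalN (5 [ startRow , var 9 ]) m ≡ proj₁ (g i)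
        read-prob i m inv@(_ , _ , _ , g-eq) i-eq =
          trans (cong₂ (num m 5) (row-eq m inv) i-eq) (cong proj₁ (g-eq i))

        -- The fold starts from entry `0` of the row, which exists because some entry has cost `D`.
        minimum-eq : foldl (λ d x → proj₂ x ℚ.⊓ d) (proj₂ (g 0)) (readTo g l) ≡ D
        minimum-eq = foldl-⊓ (All.lookup D≤ (subst (g 0 ∈_) g-reads (∈-readTo g 0<l)))
                       (subst (All _) (sym g-reads) D≤) (inj₂ (subst (Any _) (sym g-reads) D∈))
          where
          0<l : 0 < l
          0<l = Any⇒0<length D∈

        findDistanceE : ∀ m → ScanInv m → Exec findDistance m (B * (12 + (30 + 22 + 22))) MinInv₀
        findDistanceE m inv@(_ , _ , _ , g-eq) = weaken
          (≤-trans (+-monoʳ-≤ 12 (forTime-short (4 [ startRow , lit 0 ]) 30 (short (suc n) s ≤-refl s<n)))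
                   (scale-+ 12 (30 + 22 + 22)))
          (λ _ (inv , eq) → inv , trans eq minimum-eq)
          (seqE (numE {Q = MinInv 0} (inv , trans (cong (λ x → num m 4 x 0) (row-eq m inv)) (cong proj₂ (g-eq 0))))
            λ m′ → forE MinInv (λ _ _ _ inv → inv) (λ _ m (inv , _) → scan-limit m inv) body)
          where
          body : ∀ i m → i < l → idx m 9 0 0 ≡ i → MinInv i m →
                 Exec (ifte isShorter (num 6 [ lit 0 , lit 0 ]≔ 4 [ startRow , var 9 ]) skip) m 30
                      (λ m′ → idx m′ 9 0 0 ≡ i × MinInv (suc i) m′)
          body i m i<l i-eq (inv , d-eq) = ifteE yes′ no′
            where
            d = foldl (λ d x → proj₂ x ℚ.⊓ d) (proj₂ (g 0)) (readTo g i)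
            test-eq : evalB isShorter m ≡ (proj₂ (g i) ℚ.≤ᵇ d)
            test-eq = cong₂ ℚ._≤ᵇ_ (read-cost i m inv i-eq) d-eq
            step : ∀ {x} → x ≡ proj₂ (g i) ℚ.⊓ d →
                   x ≡ foldl (λ d x → proj₂ x ℚ.⊓ d) (proj₂ (g 0)) (readTo g (suc i))
            step eq = trans eq (sym (foldl-++ _ (proj₂ (g 0)) (readTo g i) _))
            yes′ : evalB isShorter m ≡ true → Exec (num 6 [ lit 0 , lit 0 ]≔ 4 [ startRow , var 9 ]) m 14
                     (λ m′ → idx m′ 9 0 0 ≡ i × MinInv (suc i) m′)
            yes′ true-eq = numE (i-eq , inv , step (trans (read-cost i m inv i-eq) done))
              where
              done : proj₂ (g i) ≡ proj₂ (g i) ℚ.⊓ d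
              done = sym (ℚ.p≤q⇒p⊓q≡p (≤ᵇ-true⇒≤ (trans (sym test-eq) true-eq)))
            no′ : evalB isShorter m ≡ false → Exec skip m 14 (λ m′ → idx m′ 9 0 0 ≡ i × MinInv (suc i) m′)
            no′ false-eq = weaken (s≤s z≤n) (λ _ q → q) (skipE (i-eq , inv , step (trans d-eq done)))
              where
              done : d ≡ proj₂ (g i) ℚ.⊓ d
              done = sym (ℚ.p≥q⇒p⊓q≡q (≤ᵇ-false⇒≥ {proj₂ (g i)} {d} (trans (sym test-eq) false-eq)))

        sumProbabilitiesE : ∀ m → MinInv₀ m → Exec sumProbabilities m (B * (4 + (38 + 22 + 22))) (SumInv l)
        sumProbabilitiesE m inv = weaken
          (≤-trans (+-monoʳ-≤ 4 (forTime-short (4 [ startRow , lit 0 ]) 38 (short (suc n) s ≤-refl s<n)))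
                   (scale-+ 4 (38 + 22 + 22)))
          (λ _ q → q)
          (seqE (numE {Q = SumInv 0} (inv , refl))
            λ m′ → forE SumInv (λ _ _ _ inv → inv) (λ _ m ((inv , _) , _) → scan-limit m inv) body)
          where
          body : ∀ i m → i < l → idx m 9 0 0 ≡ i → SumInv i m →
                 Exec (ifte withinBudget
                        (num 7 [ lit 0 , lit 0 ]≔ 7 [ lit 0 , lit 0 ] ⊕ 5 [ startRow , var 9 ]) skip) m 38
                      (λ m′ → idx m′ 9 0 0 ≡ i × SumInv (suc i) m′)
          body i m i<l i-eq (inv₀@(inv@(inp , _) , d-eq) , sum-eq) = ifteE yes′ no′
            where
            test-eq : evalB withinBudget m ≡ (proj₂ (g i) ℚ.≤ᵇ W ℚ.* D)
            test-eq = cong₂ ℚ._≤ᵇ_ (read-cost i m inv i-eq) (cong₂ ℚ._*_ (W-eq inp) d-eq)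
            step : ∀ {x} → x ≡ contribution (g i) →
                   num m 7 0 0 ℚ.+ x ≡ sumℚ (map contribution (readTo g (suc i)))
            step {x} eq = begin
              num m 7 0 0 ℚ.+ x                                                ≡⟨ cong₂ ℚ._+_ sum-eq eq ⟩
              sumℚ (map contribution (readTo g i)) ℚ.+ contribution (g i)      ≡⟨ sumℚ-∷ʳ (map contribution (readTo g i)) _ ⟨
              sumℚ (map contribution (readTo g i) ++ contribution (g i) ∷ [])  ≡⟨ cong sumℚ (map-++ contribution (readTo g i) _) ⟨
              sumℚ (map contribution (readTo g (suc i)))                       ∎
              where open ≡-Reasoning
            yes′ : evalB withinBudget m ≡ true →
                   Exec (num 7 [ lit 0 , lit 0 ]≔ 7 [ lit 0 , lit 0 ] ⊕ 5 [ startRow , var 9 ]) m 18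
                     (λ m′ → idx m′ 9 0 0 ≡ i × SumInv (suc i) m′)
            yes′ true-eq = numE (i-eq , inv₀ , step (trans (read-prob i m inv i-eq) done))
              where
              done : proj₁ (g i) ≡ contribution (g i)
              done rewrite trans (sym test-eq) true-eq = refl
            no′ : evalB withinBudget m ≡ false → Exec skip m 18 (λ m′ → idx m′ 9 0 0 ≡ i × SumInv (suc i) m′)
            no′ false-eq = weaken (s≤s z≤n) (λ _ q → q)
              (skipE (i-eq , inv₀ , trans (sym (ℚ.+-identityʳ _)) (step done)))
              where
              done : 0ℚ ≡ contribution (g i)
              done rewrite trans (sym test-eq) false-eq = refl

      eciE : ∀ m → LevelInv 0 m → Exec eci m (B * eciTime n) (λ m′ → output m′ ≡ sumℚ (map contribution paths))
      eciE m inv₀ = weaken (scale-seq _ (scale-seq 86 (scale-seq 86 (scale 6)))) (λ _ q → q)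
        (seqE (levelsE inv₀) λ m₁ (inp , b , rows) →
          let g  = entry m₁ r
              row = rows s s<n
              l-eq = Row-length {m₁} row
              g-reads = trans (cong (readTo g) (sym l-eq)) row
          in seqE (findDistanceE g g-reads m₁ (inp , b , l-eq , λ _ → refl)) λ m₂ inv₂ →
             seqE (sumProbabilitiesE g g-reads m₂ inv₂) λ m₃ (_ , sum-eq) →
             numE (trans sum-eq (cong (λ xs → sumℚ (map contribution xs)) g-reads)))

-- The time bound as a polynomial

nested-poly : ∀ c r i t k h k′ f n →
  suc n * ((n * ((r + (i + (t + (n * c + k)))) + k) + k + h) + k′) + k′ + f ≡
  evalPoly (k + h + k′ + k′ + f ∷ r + i + t + k + k + (k + h + k′) ∷ c + (r + i + t + k + k) ∷ c ∷ []) n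
nested-poly = solve 9 (λ c r i t k h k′ f n →
  (con 1 :+ n) :* ((n :* ((r :+ (i :+ (t :+ (n :* c :+ k)))) :+ k) :+ k :+ h) :+ k′) :+ k′ :+ f :=
  (k :+ h :+ k′ :+ k′ :+ f) :+ n :* ((r :+ i :+ t :+ k :+ k :+ (k :+ h :+ k′)) :+
    n :* ((c :+ (r :+ i :+ t :+ k :+ k)) :+ n :* (c :+ n :* con 0)))) refl
  where open +-*-Solver

timePoly : Poly
timePoly =
  16 + 10 + 18 + 18 + 178 ∷ resetTime + suc (timeB isTarget) + targetTime + 16 + 16 + (16 + 10 + 18) ∷
  arcTime + 16 + (resetTime + suc (timeB isTarget) + targetTime + 16 + 16) ∷ arcTime + 16 ∷ []

-- The loops over levels, vertices and successors are nested, which gives a cubic. `16` and `18` are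
-- the overheads `13 + timeI lim` for the limits `n` and `n + 1`, `10` is the advance of `idx 5`,
-- and `178` is `86 + (86 + 6)`.
eciTime-poly : ∀ n → eciTime n ≡ evalPoly timePoly n
eciTime-poly = nested-poly (arcTime + 16) resetTime (suc (timeB isTarget)) targetTime 16 10 18 178

-- Counting paths

module _ {A I : Set} {R : I → A → Set} (R? : ∀ i → Decidable (R i)) where

  private
    Agree : I → A → A → Set
    Agree i x y = (R i x → R i y) × (R i y → R i x)

    length-split : ∀ {P : A → Set} (P? : Decidable P) xs →
                   length xs ≡ length (filter P? xs) + length (filter (¬? ∘ P?) xs)
    length-split P? [] = refl
    length-split P? (x ∷ xs) with P? x
    ... | yes _ = cong suc (length-split P? xs)
    ... | no  _ = trans (cong suc (length-split P? xs)) (sym (+-suc _ _))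

  -- Induction on `is`: after a split by `R i`, the members of each half agree on the test `i`, so
  -- the remaining tests separate them.
  separated⇒length≤2^ : ∀ (is : List I) {xs} → Unique xs →
    (∀ {x y} → x ∈ xs → y ∈ xs → All (λ i → Agree i x y) is → x ≡ y) → length xs ≤ 2 ^ length is
  separated⇒length≤2^ [] {[]}         _ sep = z≤n
  separated⇒length≤2^ [] {x ∷ []}     _ sep = s≤s z≤n
  separated⇒length≤2^ [] {x ∷ y ∷ xs} ((x≢y ∷ _) ∷ _) sep = ⊥-elim (x≢y (sep (here refl) (there (here refl)) []))
  separated⇒length≤2^ (i ∷ is) {xs} uniq sep = begin
    length xs                                                      ≡⟨ length-split (R? i) xs ⟩
    length (filter (R? i) xs) + length (filter (¬? ∘ R? i) xs)     ≤⟨ +-mono-≤ with-i without-i ⟩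
    2 ^ length is + 2 ^ length is                                  ≡⟨ cong (2 ^ length is +_) (+-identityʳ _) ⟨
    2 ^ length (i ∷ is)                                            ∎
    where
    open ≤-Reasoning
    with-i : length (filter (R? i) xs) ≤ 2 ^ length is
    with-i = separated⇒length≤2^ is (Unique.filter⁺ (R? i) uniq) λ x∈ y∈ agree →
      let x∈xs , Rx = ∈-filter⁻ (R? i) x∈
          y∈xs , Ry = ∈-filter⁻ (R? i) y∈
      in sep x∈xs y∈xs (((λ _ → Ry) , (λ _ → Rx)) ∷ agree)
    without-i : length (filter (¬? ∘ R? i) xs) ≤ 2 ^ length is
    without-i = separated⇒length≤2^ is (Unique.filter⁺ (¬? ∘ R? i) uniq) λ x∈ y∈ agree →
      let x∈xs , ¬Rx = ∈-filter⁻ (¬? ∘ R? i) x∈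
          y∈xs , ¬Ry = ∈-filter⁻ (¬? ∘ R? i) y∈
      in sep x∈xs y∈xs (((λ Rx → ⊥-elim (¬Rx Rx)) , (λ Ry → ⊥-elim (¬Ry Ry))) ∷ agree)

-- Assembling a cycle from two walks

module _ {V : Set} {_~_ : V → V → Set} where

  Linked-join : ∀ xs {a b c ys} → Linked _~_ (a ∷ xs ∷ʳ b) → Linked _~_ (b ∷ ys ∷ʳ c) →
                Linked _~_ (a ∷ (xs ++ b ∷ ys) ∷ʳ c)
  Linked-join []       (r ∷ _) l = r ∷ l
  Linked-join (x ∷ xs) (r ∷ k) l = r ∷ Linked-join xs k l

  Linked-reverse : (∀ {a b} → a ~ b → b ~ a) → ∀ xs {a b} →
                   Linked _~_ (a ∷ xs ∷ʳ b) → Linked _~_ (b ∷ reverse xs ∷ʳ a)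
  Linked-reverse sym~ []       (r ∷ _) = sym~ r ∷ [-]
  Linked-reverse sym~ (x ∷ xs) {a} {b} (r ∷ l) =
    subst (λ ys → Linked _~_ (b ∷ ys ∷ʳ a)) (sym (unfold-reverse x xs))
      (Linked-join (reverse xs) (Linked-reverse sym~ xs l) (sym~ r ∷ [-]))

Unique-reverse : {A : Set} {xs : List A} → Unique xs → Unique (reverse xs)
Unique-reverse {xs = []}     _ = []
Unique-reverse {xs = x ∷ xs} uniq@(_ ∷ uniq′) =
  subst Unique (sym (unfold-reverse x xs))
    (Unique.++⁺ (Unique-reverse uniq′) ([] ∷ [])
      λ { (y∈ , here refl) → Unique.Unique[x∷xs]⇒x∉xs uniq (Any.reverse⁻ y∈) })

Unique-∷ : {A : Set} {x : A} {xs : List A} → x ∉ xs → Unique xs → Unique (x ∷ xs)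
Unique-∷ x∉xs uniq = All.tabulate (λ y∈xs x≡y → x∉xs (subst (_∈ _) (sym x≡y) y∈xs)) ∷ uniq

Unique⇒lookup-injective : {A : Set} {xs : List A} → Unique xs → ∀ {i j} → lookup xs i ≡ lookup xs j → i ≡ j
Unique⇒lookup-injective {xs = x ∷ xs} _ {Fin.zero} {Fin.zero} eq = refl
Unique⇒lookup-injective {xs = x ∷ xs} u {Fin.zero} {Fin.suc j} eq =
  ⊥-elim (Unique.Unique[x∷xs]⇒x∉xs u (subst (_∈ xs) (sym eq) (∈-lookup j)))
Unique⇒lookup-injective {xs = x ∷ xs} u {Fin.suc i} {Fin.zero} eq =
  ⊥-elim (Unique.Unique[x∷xs]⇒x∉xs u (subst (_∈ xs) eq (∈-lookup i)))
Unique⇒lookup-injective {xs = x ∷ xs} (_ ∷ u) {Fin.suc i} {Fin.suc j} eq =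
  cong Fin.suc (Unique⇒lookup-injective u eq)

-- Paths in an acyclic digraph

module Paths {n : ℕ} (G : DAG n) where
  open DAG G

  private
    V : Set
    V = Fin n

  open DecMembership (Fin._≟_ {n}) using () renaming (_∈?_ to _∈V?_)
  open DecMembership (Product.≡-dec (Fin._≟_ {n}) (Fin._≟_ {n})) using () renaming (_∈?_ to _∈E?_)

  -- The end is left out so that the vertex lists of two segments with a common end can be joined
  -- without repeating it.
  sources : ∀ {u x} → Path u x → List V
  sources []              = []
  sources (_∷_ {u} _ P) = u ∷ sources P

  vertices : ∀ {u x} → Path u x → List V
  vertices {x = x} []     = x ∷ []
  vertices (_∷_ {u} _ P) = u ∷ vertices P

  arcs : ∀ {u x} → Path u x → List (V × V)
  arcs []                  = []
  arcs (_∷_ {u} {v} _ P) = (u , v) ∷ arcs P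

  infixr 5 _⁀_
  _⁀_ : ∀ {u v x} → Path u v → Path v x → Path u x
  []      ⁀ Q = Q
  (e ∷ P) ⁀ Q = e ∷ (P ⁀ Q)

  start∈ : ∀ {u x} (P : Path u x) → u ∈ vertices P
  start∈ []      = here refl
  start∈ (_ ∷ _) = here refl

  end∈ : ∀ {u x} (P : Path u x) → x ∈ vertices P
  end∈ []      = here refl
  end∈ (_ ∷ P) = there (end∈ P)

  source∈vertices : ∀ {u x y} (P : Path u x) → y ∈ sources P → y ∈ vertices P
  source∈vertices (_ ∷ P) (here eq)  = here eq
  source∈vertices (_ ∷ P) (there y∈) = there (source∈vertices P y∈)

  arc⇒source : ∀ {u x a b} (P : Path u x) → (a , b) ∈ arcs P → a ∈ sources P
  arc⇒source (_ ∷ P) (here refl) = here refl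
  arc⇒source (_ ∷ P) (there e∈)  = there (arc⇒source P e∈)

  arc⇒Arc : ∀ {u x a b} (P : Path u x) → (a , b) ∈ arcs P → Arc a b
  arc⇒Arc (e ∷ P) (here refl) = e
  arc⇒Arc (_ ∷ P) (there e∈)  = arc⇒Arc P e∈

  vertex⇒path : ∀ {u x y} (P : Path u x) → y ∈ vertices P → Path u y
  vertex⇒path []      (here refl) = []
  vertex⇒path (_ ∷ P) (here refl) = []
  vertex⇒path (e ∷ P) (there y∈)  = e ∷ vertex⇒path P y∈

  source⇒arc-path : ∀ {u x y} (P : Path u x) → y ∈ sources P → ∃[ v ] Arc y v × Path v x
  source⇒arc-path (e ∷ P) (here refl) = _ , e , P
  source⇒arc-path (_ ∷ P) (there y∈)  = source⇒arc-path P y∈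

  tail-avoids-start : ∀ {u v x} → Arc u v → (P : Path v x) → u ∉ vertices P
  tail-avoids-start e P u∈ = acyclic e (vertex⇒path P u∈)

  vertices-unique : ∀ {u x} (P : Path u x) → Unique (vertices P)
  vertices-unique []      = [] ∷ []
  vertices-unique (e ∷ P) = Unique-∷ (tail-avoids-start e P) (vertices-unique P)

  sources-unique : ∀ {u x} (P : Path u x) → Unique (sources P)
  sources-unique []      = []
  sources-unique (e ∷ P) = Unique-∷ (tail-avoids-start e P ∘ source∈vertices P) (sources-unique P)

  end∉sources : ∀ {u x} (P : Path u x) → x ∉ sources P
  end∉sources P x∈ with source⇒arc-path P x∈
  ... | _ , e , Q = acyclic e Q

  -- Pigeonhole, since acyclicity keeps a path from repeating a vertex.
  vertices-≤ : ∀ {u x} (P : Path u x) → length (vertices P) ≤ n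
  vertices-≤ P = Fin.injective⇒≤ (Unique⇒lookup-injective (vertices-unique P))

  record Split {u y} (P : Path u y) (x : V) : Set where
    constructor split
    field
      {before}      : Path u x
      {after}       : Path x y
      before⁀after : before ⁀ after ≡ P

  split-at : ∀ {u x y} (P : Path u x) → y ∈ vertices P → Split P y
  split-at []      (here refl) = split {before = []} {[]} refl
  split-at (e ∷ P) (here refl) = split {before = []} {e ∷ P} refl
  split-at (e ∷ P) (there y∈) with split-at P y∈
  ... | split {Q} {R} refl = split {before = e ∷ Q} {R} refl

  vertices-⁀⁻ : ∀ {u v x y} (P : Path u v) (Q : Path v x) → y ∈ vertices (P ⁀ Q) → y ∈ sources P ⊎ y ∈ vertices Q
  vertices-⁀⁻ []      Q y∈         = inj₂ y∈
  vertices-⁀⁻ (e ∷ P) Q (here eq)  = inj₁ (here eq)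
  vertices-⁀⁻ (e ∷ P) Q (there y∈) = [ inj₁ ∘ there , inj₂ ]′ (vertices-⁀⁻ P Q y∈)

  sources-⁀⁺ : ∀ {u v x y} (P : Path u v) (Q : Path v x) → y ∈ sources P → y ∈ vertices (P ⁀ Q)
  sources-⁀⁺ (e ∷ P) Q (here eq)  = here eq
  sources-⁀⁺ (e ∷ P) Q (there y∈) = there (sources-⁀⁺ P Q y∈)

  arcs-⁀⁺ : ∀ {u v x e} (P : Path u v) (Q : Path v x) → e ∈ arcs P → e ∈ arcs (P ⁀ Q)
  arcs-⁀⁺ (e ∷ P) Q (here eq)  = here eq
  arcs-⁀⁺ (e ∷ P) Q (there y∈) = there (arcs-⁀⁺ P Q y∈)

  -- x is the first vertex of P that lies on Q.
  record Meeting {u v t} (P : Path u t) (Q : Path v t) : Set where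
    constructor meeting
    field
      {x}    : V
      splitP : Split P x
      splitQ : Split Q x
      offQ   : ∀ {y} → y ∈ sources (Split.before splitP) → y ∉ vertices Q

  -- The search along `P` succeeds at the common end `t` at the latest.
  meet : ∀ {u v t} (P : Path u t) (Q : Path v t) → Meeting P Q
  meet {u} P Q with u ∈V? vertices Q
  meet P Q       | yes u∈Q = meeting (split {before = []} {P} refl) (split-at Q u∈Q) λ ()
  meet []      Q | no u∉Q = ⊥-elim (u∉Q (end∈ Q))
  meet (e ∷ P) Q | no u∉Q with meet P Q
  ... | meeting (split {P₁} {P₂} refl) sQ off =
    meeting (split {before = e ∷ P₁} {P₂} refl) sQ λ { (here refl) → u∉Q ; (there y∈) → off y∈ }

  -- Symmetry: an interior vertex of the Q-segment on P would close a directed cycle through x.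
  meeting-offP : ∀ {u v t} {P : Path u t} {Q : Path v t} (M : Meeting P Q) → let open Meeting M in
                 ∀ {y} → y ∈ sources (Split.before splitQ) → y ∉ vertices P
  meeting-offP (meeting (split {P₁} {P₂} refl) (split {Q₁} {Q₂} refl) off) {y} y∈Q₁ y∈P
    with vertices-⁀⁻ P₁ P₂ y∈P
  ... | inj₁ y∈P₁ = off y∈P₁ (sources-⁀⁺ Q₁ Q₂ y∈Q₁)
  ... | inj₂ y∈P₂ with source⇒arc-path Q₁ y∈Q₁
  ...   | _ , e , R = acyclic e (R ⁀ vertex⇒path P₂ y∈P₂)

  -- Either orientation counts, since a pair in `S` stands for an undirected edge.
  Uses : V × V → ∀ {u x} → Path u x → Set
  Uses (a , b) P = (a , b) ∈ arcs P ⊎ (b , a) ∈ arcs P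

  uses? : ∀ e {u x} (P : Path u x) → Dec (Uses e P)
  uses? (a , b) P = ((a , b) ∈E? arcs P) ⊎-dec ((b , a) ∈E? arcs P)

  Agree : V × V → ∀ {u x} → Path u x → Path u x → Set
  Agree e P Q = (Uses e P → Uses e Q) × (Uses e Q → Uses e P)


  -- A path is determined by its edges in a feedback edge set

  module _ {S : List (V × V)} (forest : Forest (UAdjWithout G S)) where

    private
      _~_ = UAdjWithout G S

      ~-sym : ∀ {a b} → a ~ b → b ~ a
      ~-sym (inj₁ e , ab∉ , ba∉) = inj₂ e , ba∉ , ab∉
      ~-sym (inj₂ e , ab∉ , ba∉) = inj₁ e , ba∉ , ab∉

      linked : ∀ {u v x} (e : Arc u v) (P : Path v x) → (∀ {a b} → (a , b) ∈ arcs (e ∷ P) → a ~ b) →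
               Linked _~_ (u ∷ sources P ∷ʳ x)
      linked e []      adjacent = adjacent (here refl) ∷ [-]
      linked e (f ∷ P) adjacent = adjacent (here refl) ∷ linked f P (adjacent ∘ there)

    -- An arc of e ∷ P₁ in S would also be used by f ∷ Q, which leaves u by a
    -- different arc and avoids the other sources of P₁.
    segment-avoids-S : ∀ {u v v′ x t} {e : Arc u v} {f : Arc u v′} → v ≢ v′ →
      (P₁ : Path v x) (P₂ : Path x t) (Q : Path v′ t) →
      All (λ g → Agree g (e ∷ (P₁ ⁀ P₂)) (f ∷ Q)) S → (∀ {y} → y ∈ sources P₁ → y ∉ vertices Q) →
      ∀ {a b} → (a , b) ∈ arcs (e ∷ P₁) → a ~ b
    segment-avoids-S {u} {e = e} {f} v≢v′ P₁ P₂ Q agree off {a} {b} ab∈P =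
      inj₁ ab , (λ ab∈S → unused (proj₁ (All.lookup agree ab∈S) (inj₁ ab∈))) ,
                (λ ba∈S → unused ([ inj₂ , inj₁ ]′ (proj₁ (All.lookup agree ba∈S) (inj₂ ab∈))))
      where
      ab : Arc a b
      ab = arc⇒Arc (e ∷ P₁) ab∈P
      ab∈ : (a , b) ∈ arcs (e ∷ (P₁ ⁀ P₂))
      ab∈ = arcs-⁀⁺ (e ∷ P₁) P₂ ab∈P
      not-in-Q : ∀ {a b} → (a , b) ∈ arcs (e ∷ P₁) → (a , b) ∉ arcs (f ∷ Q)
      not-in-Q (here refl)  (here refl)  = v≢v′ refl
      not-in-Q (here refl)  (there ab∈Q) = tail-avoids-start f Q (source∈vertices Q (arc⇒source Q ab∈Q))
      not-in-Q (there ab∈P) (here refl)  = tail-avoids-start e P₁ (source∈vertices P₁ (arc⇒source P₁ ab∈P))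
      not-in-Q (there ab∈P) (there ab∈Q) = off (arc⇒source P₁ ab∈P) (source∈vertices Q (arc⇒source Q ab∈Q))
      unused : ¬ Uses (a , b) (f ∷ Q)
      unused (inj₁ ab∈Q) = not-in-Q ab∈P ab∈Q
      unused (inj₂ ba∈Q) = acyclic ab (arc⇒Arc (f ∷ Q) ba∈Q ∷ [])

    -- The forbidden cycle runs from `u` along `P₁` to the meeting vertex `x` and returns along the
    -- reverse of `Q₁`. `segment-avoids-S` is applied to each path in turn, which is where both
    -- `offQ` and `offP` enter.
    diverging⇒⊥ : ∀ {u v v′ t} {e : Arc u v} {f : Arc u v′} → v ≢ v′ →
                  (P : Path v t) (Q : Path v′ t) → All (λ g → Agree g (e ∷ P) (f ∷ Q)) S → ⊥
    diverging⇒⊥ {u} {v} {v′} {t} {e} {f} v≢v′ P Q agree with meet P Q | meeting-offP {P = P} {Q}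
    ... | meeting {x} (split {P₁} {P₂} refl) (split {Q₁} {Q₂} refl) offQ | offP = forest record
      { start    = u
      ; rest     = sources P₁ ++ x ∷ reverse (sources Q₁)
      ; long     = long P₁ Q₁ v≢v′
      ; distinct = Unique-∷ u∉ (Unique.++⁺ (sources-unique P₁)
                     (Unique-∷ (end∉sources Q₁ ∘ Any.reverse⁻) (Unique-reverse (sources-unique Q₁)))
                     λ { (y∈P₁ , here refl)   → end∉sources P₁ y∈P₁
                       ; (y∈P₁ , there y∈Q₁) → offQ y∈P₁ (sources-⁀⁺ Q₁ Q₂ (Any.reverse⁻ y∈Q₁)) })
      ; closed   = Linked-join (sources P₁)
                     (linked e P₁ (segment-avoids-S {e = e} {f} v≢v′ P₁ P₂ Q agree offQ))
                     (Linked-reverse ~-sym (sources Q₁)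
                       (linked f Q₁ (segment-avoids-S {e = f} {e} (v≢v′ ∘ sym) Q₁ Q₂ P
                         (All.map (λ (p , q) → q , p) agree)
                         (offP (meeting (split {before = P₁} {P₂} refl) (split {before = Q₁} {Q₂} refl) offQ)))))
      }
      where
      -- If both segments were empty, the arcs `e` and `f` would have the same head; so some segment
      -- contributes a vertex besides `x`.
      long : ∀ {x v v′} (P₁ : Path v x) (Q₁ : Path v′ x) → v ≢ v′ → 2 ≤ length (sources P₁ ++ x ∷ reverse (sources Q₁))
      long []      []       v≢v′ = ⊥-elim (v≢v′ refl)
      long []      (f ∷ Q₁) v≢v′ = s≤s (≤-trans (s≤s z≤n) (≤-reflexive (sym (length-reverse (_ ∷ sources Q₁)))))
      long (e ∷ P₁) Q₁      v≢v′ = s≤s (≤-trans (≤-trans (s≤s z≤n) (m≤n+m _ (length (sources P₁)))) (≤-reflexive (sym (length-++ (sources P₁)))))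
      u∉ : u ∉ sources P₁ ++ x ∷ reverse (sources Q₁)
      u∉ u∈ with ∈-++⁻ (sources P₁) u∈
      ... | inj₁ u∈P₁         = tail-avoids-start e P₁ (source∈vertices P₁ u∈P₁)
      ... | inj₂ (here refl)  = acyclic e P₁
      ... | inj₂ (there u∈Q₁) = tail-avoids-start f Q₁ (source∈vertices Q₁ (Any.reverse⁻ u∈Q₁))

    -- Common first arcs are stripped until the paths end or diverge. Agreement passes to the tails
    -- because, by acyclicity, no tail uses the edge just removed.
    agree⇒≡ : ∀ {u t} (P Q : Path u t) → All (λ g → Agree g P Q) S → P ≡ Q
    agree⇒≡ []      []      _ = refl
    agree⇒≡ []      (f ∷ Q) _ = ⊥-elim (acyclic f Q)
    agree⇒≡ (e ∷ P) []      _ = ⊥-elim (acyclic e P)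
    agree⇒≡ (_∷_ {u} {v} e P) (_∷_ {v = v′} f Q) agree with v Fin.≟ v′
    ... | no v≢v′ = ⊥-elim (diverging⇒⊥ {e = e} {f} v≢v′ P Q agree)
    ... | yes refl with T-irrelevant e f
    ...   | refl = cong (e ∷_) (agree⇒≡ P Q (All.map (λ {g} (p , q) → drop P Q p , drop Q P q) agree))
      where
      drop : ∀ {g} (P Q : Path v _) → (Uses g (e ∷ P) → Uses g (e ∷ Q)) → Uses g P → Uses g Q
      drop P Q h uses = tail uses (h ([ inj₁ ∘ there , inj₂ ∘ there ]′ uses))
        where
        u∉ : ∀ {b} → (u , b) ∉ arcs P
        u∉ ub∈ = tail-avoids-start e P (source∈vertices P (arc⇒source P ub∈))
        tail : ∀ {g} → Uses g P → Uses g (e ∷ Q) → Uses g Q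
        tail _           (inj₁ (there g∈)) = inj₁ g∈
        tail _           (inj₂ (there g∈)) = inj₂ g∈
        tail (inj₁ ab∈P) (inj₁ (here refl)) = ⊥-elim (u∉ ab∈P)
        tail (inj₂ ba∈P) (inj₁ (here refl)) = ⊥-elim (acyclic e (arc⇒Arc P ba∈P ∷ []))
        tail (inj₁ ab∈P) (inj₂ (here refl)) = ⊥-elim (acyclic e (arc⇒Arc P ab∈P ∷ []))
        tail (inj₂ ba∈P) (inj₂ (here refl)) = ⊥-elim (u∉ ba∈P)

    paths≤2^ : ∀ {u t} {Ps : List (Path u t)} → Unique Ps → length Ps ≤ 2 ^ length S
    paths≤2^ uniq = separated⇒length≤2^ {R = λ e → Uses e} (λ e → uses? e) S uniq
      (λ {P} {Q} _ _ agree → agree⇒≡ P Q agree)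

-- The algorithm computes the traversal

toℚᵘ-ℕ→ℚ : ∀ k → ℚ.toℚᵘ (ℕ→ℚ k) ℚᵘ.≃ mkℚᵘ (ℤ.+ k) 0
toℚᵘ-ℕ→ℚ k = ℚ.toℚᵘ-fromℚᵘ (mkℚᵘ (ℤ.+ k) 0)

ℕ→ℚ-homo-+ : ∀ a b → ℕ→ℚ (a + b) ≡ ℕ→ℚ a ℚ.+ ℕ→ℚ b
ℕ→ℚ-homo-+ a b = ℚ.toℚᵘ-injective (begin
  ℚ.toℚᵘ (ℕ→ℚ (a + b))                   ≈⟨ toℚᵘ-ℕ→ℚ (a + b) ⟩
  mkℚᵘ (ℤ.+ (a + b)) 0                    ≈⟨ *≡* (cong (ℤ._* ℤ.1ℤ) (sym (cong₂ ℤ._+_ (ℤ.*-identityʳ (ℤ.+ a)) (ℤ.*-identityʳ (ℤ.+ b))))) ⟩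
  mkℚᵘ (ℤ.+ a) 0 ℚᵘ.+ mkℚᵘ (ℤ.+ b) 0     ≈⟨ ℚᵘ.+-cong (toℚᵘ-ℕ→ℚ a) (toℚᵘ-ℕ→ℚ b) ⟨
  ℚ.toℚᵘ (ℕ→ℚ a) ℚᵘ.+ ℚ.toℚᵘ (ℕ→ℚ b)    ≈⟨ ℚ.toℚᵘ-homo-+ (ℕ→ℚ a) (ℕ→ℚ b) ⟨
  ℚ.toℚᵘ (ℕ→ℚ a ℚ.+ ℕ→ℚ b)               ∎)
  where open ℚᵘ.≃-Reasoning

ℕ→ℚ-mono-≤ : ∀ {a b} → a ≤ b → ℕ→ℚ a ℚ.≤ ℕ→ℚ b
ℕ→ℚ-mono-≤ {a} {b} a≤b = ℚ.toℚᵘ-cancel-≤ (begin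
  ℚ.toℚᵘ (ℕ→ℚ a)  ≃⟨ toℚᵘ-ℕ→ℚ a ⟩
  mkℚᵘ (ℤ.+ a) 0   ≤⟨ *≤* (ℤ.*-monoʳ-≤-nonNeg ℤ.1ℤ (ℤ.+≤+ a≤b)) ⟩
  mkℚᵘ (ℤ.+ b) 0   ≃⟨ toℚᵘ-ℕ→ℚ b ⟨
  ℚ.toℚᵘ (ℕ→ℚ b)  ∎)
  where open ℚᵘ.≤-Reasoning

/-* : ∀ c d .{{_ : NonZero d}} → (ℤ.+ c ℚ./ d) ℚ.* ℕ→ℚ d ≡ ℕ→ℚ c
/-* c (suc d) = ℚ.toℚᵘ-injective (begin
  ℚ.toℚᵘ (ℤ.+ c ℚ./ suc d ℚ.* ℕ→ℚ (suc d))            ≈⟨ ℚ.toℚᵘ-homo-* (ℤ.+ c ℚ./ suc d) (ℕ→ℚ (suc d)) ⟩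
  ℚ.toℚᵘ (ℤ.+ c ℚ./ suc d) ℚᵘ.* ℚ.toℚᵘ (ℕ→ℚ (suc d))  ≈⟨ ℚᵘ.*-cong (ℚ.toℚᵘ-fromℚᵘ (mkℚᵘ (ℤ.+ c) d)) (toℚᵘ-ℕ→ℚ (suc d)) ⟩
  mkℚᵘ (ℤ.+ c) d ℚᵘ.* mkℚᵘ (ℤ.+ suc d) 0                ≈⟨ *≡* (trans (ℤ.*-identityʳ _) (cong (λ k → ℤ.+ c ℤ.* ℤ.+ k) (sym (*-identityʳ (suc d))))) ⟩
  mkℚᵘ (ℤ.+ c) 0                                         ≈⟨ toℚᵘ-ℕ→ℚ c ⟨
  ℚ.toℚᵘ (ℕ→ℚ c)                                        ∎)
  where open ℚᵘ.≃-Reasoning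

-- Multiplication by the positive number `d` preserves and reflects the order, so the test without
-- division decides `X ≤ W`.
≤ᵇ≡does-≤? : ∀ c d W .{{_ : NonZero d}} → (ℕ→ℚ c ℚ.≤ᵇ W ℚ.* ℕ→ℚ d) ≡ does (ℤ.+ c ℚ./ d ℚ.≤? W)
≤ᵇ≡does-≤? c d W with ℕ→ℚ c ℚ.≤ᵇ W ℚ.* ℕ→ℚ d in eq
... | true  = sym (dec-true (ℤ.+ c ℚ./ d ℚ.≤? W)
                (ℚ.*-cancelʳ-≤-pos {ℤ.+ c ℚ./ d} {W} (ℕ→ℚ d) {{ℚ.normalize-pos d 1}}
                  (subst (ℚ._≤ W ℚ.* ℕ→ℚ d) (sym (/-* c d)) (≤ᵇ-true⇒≤ eq))))
... | false = sym (dec-false (ℤ.+ c ℚ./ d ℚ.≤? W) λ X≤W → subst T eq (ℚ.≤⇒≤ᵇ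
                (subst (ℚ._≤ W ℚ.* ℕ→ℚ d) (/-* c d)
                  (ℚ.*-monoʳ-≤-nonNeg (ℕ→ℚ d) {{ℚ.normalize-nonNeg d 1}} {ℤ.+ c ℚ./ d} {W} X≤W))))

tabulate₂-toℕ : {A : Set} {n : ℕ} (z : A) (f : Fin n → Fin n → A) (u v : Fin n) →
                tabulate₂ z f (toℕ u) (toℕ v) ≡ f u v
tabulate₂-toℕ {n = n} z f u v with toℕ u <? n | toℕ v <? n
... | yes u<n | yes v<n = cong₂ f (Fin.fromℕ<-toℕ u u<n) (Fin.fromℕ<-toℕ v v<n)
... | yes _   | no v≮n  = ⊥-elim (v≮n (Fin.toℕ<n v))
... | no u≮n  | _       = ⊥-elim (u≮n (Fin.toℕ<n u))

catTo-suc : {A : Set} (f : ℕ → List A) (k : ℕ) → catTo f (suc k) ≡ f 0 ++ catTo (f ∘ suc) k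
catTo-suc f zero    = sym (++-identityʳ (f 0))
catTo-suc f (suc k) = trans (cong (_++ f (suc k)) (catTo-suc f k)) (++-assoc (f 0) _ _)

catTo-tabulate : {A : Set} (f : ℕ → List A) (k : ℕ) → catTo f k ≡ concat (tabulate {n = k} (f ∘ toℕ))
catTo-tabulate f zero    = refl
catTo-tabulate f (suc k) = trans (catTo-suc f k) (cong (f 0 ++_) (catTo-tabulate (f ∘ suc) k))

-- Reconciles the order of the loop, which grows a list at its end, with `concatMap`, which unfolds
-- from the front.
catTo-allFin : {A : Set} (f : ℕ → List A) (k : ℕ) → catTo f k ≡ concatMap (f ∘ toℕ) (allFin k)
catTo-allFin f k = trans (catTo-tabulate f k) (cong concat (sym (map-tabulate {n = k} id (f ∘ toℕ))))

-- The paths listed by the traversal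

module Traversal {n : ℕ} (M : PlanningModel n) where
  open PlanningModel M
  open Paths G

  -- A named copy of the function local to `traversal`; `step≗moves` identifies the two.
  moves : ℕ → ∀ u v → Dist (Path u t)
  moves k u v with T? (adj u v)
  ... | yes e = map (λ (q , P) → p u v ℚ.* q , e ∷ P) (traversal M k v)
  ... | no _  = []

  traversal-end : ∀ k → traversal M k t ≡ (1ℚ , []) ∷ []
  traversal-end k with t Fin.≟ t
  ... | yes refl = refl
  ... | no t≢t   = ⊥-elim (t≢t refl)

  traversal-zero : ∀ {u} → u ≢ t → traversal M 0 u ≡ []
  traversal-zero {u} u≢t with u Fin.≟ t
  ... | yes u≡t = ⊥-elim (u≢t u≡t)
  ... | no _    = refl

  -- Gives a name to the function local to the definition of traversal.
  private
    step : ∀ k {u} → u ≢ t → ∃[ f ] traversal M (suc k) u ≡ concatMap f (allFin n)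
    step k {u} u≢t with u Fin.≟ t
    ... | yes u≡t = ⊥-elim (u≢t u≡t)
    ... | no _    = _ , refl

    step≗moves : ∀ k {u} (u≢t : u ≢ t) → proj₁ (step k u≢t) ≗ moves k u
    step≗moves k {u} u≢t v with u Fin.≟ t
    ... | yes u≡t = ⊥-elim (u≢t u≡t)
    ... | no _ with T? (adj u v)
    ...   | yes _ = refl
    ...   | no _  = refl

  traversal-suc : ∀ k {u} → u ≢ t → traversal M (suc k) u ≡ concatMap (moves k u) (allFin n)
  traversal-suc k u≢t = trans (proj₂ (step k u≢t)) (concatMap-cong (step≗moves k u≢t) (allFin n))

  paths-from : ℕ → ∀ u → List (Path u t)
  paths-from k u = map proj₂ (traversal M k u)

  movePaths : ℕ → ∀ u v → List (Path u t)
  movePaths k u v = map proj₂ (moves k u v)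

  paths-suc : ∀ k {u} → u ≢ t → paths-from (suc k) u ≡ concatMap (movePaths k u) (allFin n)
  paths-suc k {u} u≢t = trans (cong (map proj₂) (traversal-suc k u≢t)) (map-concatMap proj₂ (moves k u) (allFin n))

  movePaths-view : ∀ k u v → (∃[ e ] movePaths k u v ≡ map (e ∷_) (paths-from k v)) ⊎
                             (¬ Arc u v × movePaths k u v ≡ [])
  movePaths-view k u v with T? (adj u v)
  ... | yes e = inj₁ (e , trans (sym (map-∘ (traversal M k v))) (map-∘ (traversal M k v)))
  ... | no ¬e = inj₂ (¬e , refl)

  ∈-movePaths : ∀ k u v {P} → P ∈ movePaths k u v → Σ[ e ∈ Arc u v ] Σ[ Q ∈ Path v t ] P ≡ e ∷ Q
  ∈-movePaths k u v P∈ with movePaths-view k u v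
  ... | inj₂ (_ , eq) = ⊥-elim (Any.¬Any[] (subst (_ ∈_) eq P∈))
  ... | inj₁ (e , eq) with ∈-map⁻ (e ∷_) (subst (_ ∈_) eq P∈)
  ...   | Q , _ , P≡ = e , Q , P≡

  -- Paths through different successors differ in their first arc, and for one successor prefixing
  -- the arc is injective.
  paths-unique : ∀ k {u} → Dec (u ≡ t) → Unique (paths-from k u)
  paths-unique k       (yes refl) rewrite traversal-end k = [] ∷ []
  paths-unique zero    (no u≢t)   rewrite traversal-zero u≢t = []
  paths-unique (suc k) {u} (no u≢t) rewrite paths-suc k u≢t =
    Unique.concat⁺ (All.map⁺ (All.tabulate λ {v} _ → unique-moves v))
      (AllPairs.map⁺ (AllPairs.map disjoint (Unique.allFin⁺ n)))
    where
    unique-moves : ∀ v → Unique (movePaths k u v)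
    unique-moves v with movePaths-view k u v
    ... | inj₂ (_ , eq) = subst Unique (sym eq) []
    ... | inj₁ (e , eq) = subst Unique (sym eq) (Unique.map⁺ (λ { refl → refl }) (paths-unique k (v Fin.≟ t)))
    disjoint : ∀ {v v′} → v ≢ v′ → Disjoint (movePaths k u v) (movePaths k u v′)
    disjoint {v} {v′} v≢v′ (P∈ , P∈′) with ∈-movePaths k u v P∈ | ∈-movePaths k u v′ P∈′
    ... | _ , _ , refl | _ , _ , refl = v≢v′ refl

  paths-complete : ∀ k {u} (P : Path u t) → length (sources P) ≤ k → P ∈ paths-from k u
  paths-complete k [] _ rewrite traversal-end k = here refl
  paths-complete (suc k) (_∷_ {u} {v} e P) (s≤s P≤k) =
    subst ((e ∷ P) ∈_) (sym (paths-suc k (λ { refl → acyclic e P })))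
      (∈-concatMap⁺ (movePaths k u) (lose (∈-allFin v) e∷P∈))
    where
    e∷P∈ : (e ∷ P) ∈ movePaths k u v
    e∷P∈ with movePaths-view k u v
    ... | inj₂ (¬e , _) = ⊥-elim (¬e e)
    ... | inj₁ (e′ , eq) rewrite eq | T-irrelevant e e′ = ∈-map⁺ (e′ ∷_) (paths-complete k P P≤k)

  length-vertices : ∀ {u x} (P : Path u x) → length (vertices P) ≡ suc (length (sources P))
  length-vertices []      = refl
  length-vertices (_ ∷ P) = cong suc (length-vertices P)

  -- Paths of probability zero are listed too, hence the least cost in the list is `d(s,t)`. The
  -- bound `n` suffices because a path has at most `n` vertices, one more than its moves.
  all-paths : (P : Path s t) → P ∈ paths-from n s
  all-paths P = paths-complete n P (≤-trans (n≤1+n _) (≤-trans (≤-reflexive (sym (length-vertices P))) (vertices-≤ P)))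

  encode : ∀ {u} → ℚ × Path u t → Entry
  encode (q , P) = q , ℕ→ℚ (cost P)

  -- The table as an encoding of the traversal

  module _ (W : ℚ) where

    open Table n (toℕ s) (toℕ t) (tabulate₂ 0 (λ u v → if adj u v then 1 else 0)) W
      (tabulate₂ 0ℚ (λ u v → ℕ→ℚ (w u v))) (tabulate₂ 0ℚ p) public

    isArc-eq : ∀ u v → (tabulate₂ 0 (λ u v → if adj u v then 1 else 0) (toℕ u) (toℕ v) ≡ᵇ 1) ≡ adj u v
    isArc-eq u v rewrite tabulate₂-toℕ 0 (λ u v → if adj u v then 1 else 0) u v with adj u v
    ... | true  = refl
    ... | false = refl

    branch-moves : ∀ k L u v → L (toℕ v) ≡ map encode (traversal M k v) →
                   branch L (toℕ u) (toℕ v) ≡ map encode (moves k u v)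
    branch-moves k L u v L≡ with T? (adj u v)
    ... | no ¬e = cong (λ b → if b then map (extend (toℕ u) (toℕ v)) (L (toℕ v)) else [])
                    (trans (isArc-eq u v) (¬T⇒≡false ¬e))
      where
      ¬T⇒≡false : ∀ {b} → ¬ T b → b ≡ false
      ¬T⇒≡false {true}  ¬b = ⊥-elim (¬b _)
      ¬T⇒≡false {false} _  = refl
    ... | yes e = begin
      branch L (toℕ u) (toℕ v)                                          ≡⟨ cong (λ b → if b then map (extend (toℕ u) (toℕ v)) (L (toℕ v)) else []) (trans (isArc-eq u v) (Equivalence.to T-≡ e)) ⟩
      map (extend (toℕ u) (toℕ v)) (L (toℕ v))                          ≡⟨ cong (map (extend (toℕ u) (toℕ v))) L≡ ⟩
      map (extend (toℕ u) (toℕ v)) (map encode (traversal M k v))       ≡⟨ map-∘ (traversal M k v) ⟨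
      map (extend (toℕ u) (toℕ v) ∘ encode) (traversal M k v)           ≡⟨ map-cong extend-encode (traversal M k v) ⟩
      map (λ (q , P) → encode (p u v ℚ.* q , e ∷ P)) (traversal M k v)  ≡⟨ map-∘ (traversal M k v) ⟩
      map encode (map (λ (q , P) → p u v ℚ.* q , e ∷ P) (traversal M k v)) ∎
      where
      open ≡-Reasoning
      extend-encode : ∀ x → extend (toℕ u) (toℕ v) (encode x) ≡ encode (p u v ℚ.* proj₁ x , e ∷ proj₂ x)
      extend-encode (q , P) = cong₂ _,_
        (cong (ℚ._* q) (tabulate₂-toℕ 0ℚ p u v))
        (trans (cong (ℚ._+ ℕ→ℚ (cost P)) (tabulate₂-toℕ 0ℚ (λ u v → ℕ→ℚ (w u v)) u v))
               (sym (ℕ→ℚ-homo-+ (w u v) (cost P))))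

    table-end : ∀ k → table (suc k) (toℕ t) ≡ (1ℚ , 0ℚ) ∷ []
    table-end k rewrite ≡ᵇ-refl (toℕ t) = refl

    table-suc : ∀ k {u} → u ≢ t → table (suc k) (toℕ u) ≡ catTo (branch (table k) (toℕ u)) n
    table-suc k u≢t rewrite ≢⇒≡ᵇ-false (u≢t ∘ Fin.toℕ-injective) = refl

    table-traversal : ∀ k {u} → Dec (u ≡ t) → table (suc k) (toℕ u) ≡ map encode (traversal M k u)
    table-traversal k           (yes refl) = trans (table-end k) (cong (map encode) (sym (traversal-end k)))
    table-traversal zero    {u} (no u≢t) =
      trans (table-suc 0 u≢t) (trans (empty n) (cong (map encode) (sym (traversal-zero u≢t))))
      where
      empty : ∀ m → catTo (branch (table 0) (toℕ u)) m ≡ []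
      empty zero    = refl
      empty (suc m) rewrite empty m
        with tabulate₂ 0 (λ u v → if adj u v then 1 else 0) (toℕ u) m ≡ᵇ 1
      ... | true  = refl
      ... | false = refl
    table-traversal (suc k) {u} (no u≢t) = begin
      table (suc (suc k)) (toℕ u)                                        ≡⟨ table-suc (suc k) u≢t ⟩
      catTo (branch (table (suc k)) (toℕ u)) n                           ≡⟨ catTo-allFin (branch (table (suc k)) (toℕ u)) n ⟩
      concatMap (branch (table (suc k)) (toℕ u) ∘ toℕ) (allFin n)        ≡⟨ concatMap-cong (λ v → branch-moves k (table (suc k)) u v (table-traversal k (v Fin.≟ t))) (allFin n) ⟩
      concatMap (map encode ∘ moves k u) (allFin n)                      ≡⟨ map-concatMap encode (moves k u) (allFin n) ⟨
      map encode (concatMap (moves k u) (allFin n))                      ≡⟨ cong (map encode) (traversal-suc k u≢t) ⟨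
      map encode (traversal M (suc k) u)                                 ∎
      where open ≡-Reasoning

    -- The entries of a row encode pairwise distinct paths to `t`, so the count of paths applies;
    -- level `0` is empty.
    table-short : ∀ {S} → IsFeedbackEdgeSet G S → ∀ k (u : Fin n) → length (table k (toℕ u)) ≤ 2 ^ length S
    table-short fes zero    u = z≤n
    table-short {S} fes (suc k) u = begin
      length (table (suc k) (toℕ u))         ≡⟨ cong length (table-traversal k (u Fin.≟ t)) ⟩
      length (map encode (traversal M k u))  ≡⟨ length-map encode (traversal M k u) ⟩
      length (traversal M k u)               ≡⟨ length-map proj₂ (traversal M k u) ⟨
      length (paths-from k u)                ≤⟨ paths≤2^ (IsFeedbackEdgeSet.forest fes) (paths-unique k (u Fin.≟ t)) ⟩
      2 ^ length S                           ∎
      where open ≤-Reasoning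

    -- The levels run from `0` to `suc n`, hence `2 + n`.
    rowLengths : List ℕ
    rowLengths = cartesianProductWith (λ k u → length (table k (toℕ u))) (upTo (2 + n)) (allFin n)

    -- Serves as `B`. It is defined without reference to `fes`, since the run is exhibited before
    -- `k` is given; `2 ^ k` enters only in the final comparison. The default `1` ensures `1 ≤ B`.
    longestRow : ℕ
    longestRow = max 1 rowLengths

    row≤longestRow : ∀ k u → k ≤ suc n → u < n → length (table k u) ≤ longestRow
    row≤longestRow k u k≤1+n u<n = subst (λ u → length (table k u) ≤ longestRow) (Fin.toℕ-fromℕ< u<n)
      (All.lookup (xs≤max 1 rowLengths)
        (∈-cartesianProductWith⁺ (λ k u → length (table k (toℕ u))) (∈-upTo⁺ (s≤s k≤1+n)) (∈-allFin (Fin.fromℕ< u<n))))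

    longestRow≤2^ : ∀ {k} → IsFes G k → longestRow ≤ 2 ^ k
    longestRow≤2^ fes with IsFes.attained fes
    ... | S , isFES , refl = max≤v⁺ {xs = rowLengths} (m^n>0 2 (length S)) (All.tabulate bounded)
      where
      bounded : ∀ {l} → l ∈ rowLengths → l ≤ 2 ^ length S
      bounded l∈ with ∈-cartesianProductWith⁻ (λ k u → length (table k (toℕ u))) (upTo (2 + n)) (allFin n) l∈
      ... | k , u , _ , _ , refl = table-short isFES k u

    initial : LevelInv 0 (input M W)
    initial = record
      { n-eq = refl ; s-eq = refl ; t-eq = refl ; adj-eq = λ _ _ → refl
      ; W-eq = refl ; w-eq = λ _ _ → refl ; p-eq = λ _ _ → refl } , refl , λ _ _ → refl

    module _ (d : ℕ) .{{_ : NonZero d}} (distance : IsDistance M d) where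

      startTable : table (suc n) (toℕ s) ≡ map encode (traversedPath M)
      startTable = table-traversal n (s Fin.≟ t)

      distance≤ : All (λ x → ℕ→ℚ d ℚ.≤ proj₂ x) (table (suc n) (toℕ s))
      distance≤ = subst (All _) (sym startTable)
        (All.map⁺ (All.tabulate λ {(_ , P)} _ → ℕ→ℚ-mono-≤ (IsDistance.minimal distance P)))

      distance∈ : Any (λ x → proj₂ x ≡ ℕ→ℚ d) (table (suc n) (toℕ s))
      distance∈ with IsDistance.attained distance
      ... | P , refl = subst (Any _) (sym startTable)
        (Any.map⁺ (Any.map (λ eq → cong (ℕ→ℚ ∘ cost) (sym eq)) (Any.map⁻ (all-paths P))))

      open Bounded longestRow (v≤max⁺ 1 rowLengths (inj₁ ≤-refl)) row≤longestRow
      open Final (ℕ→ℚ d) distance≤ distance∈ (Fin.toℕ<n s)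

      result : sumℚ (map contribution (table (suc n) (toℕ s))) ≡ Pr[X≤_] M W d
      result = cong sumℚ (begin
        map contribution (table (suc n) (toℕ s))          ≡⟨ cong (map contribution) startTable ⟩
        map contribution (map encode (traversedPath M))   ≡⟨ map-∘ (traversedPath M) ⟨
        map (contribution ∘ encode) (traversedPath M)     ≡⟨ map-cong (λ (q , P) → cong (if_then q else 0ℚ) (≤ᵇ≡does-≤? (cost P) d W)) (traversedPath M) ⟩
        map (λ (q , P) → if does (X M d P ℚ.≤? W) then q else 0ℚ) (traversedPath M) ∎)
        where open ≡-Reasoning

      eci-correct : Exec eci (input M W) (longestRow * eciTime n) (λ m → output m ≡ Pr[X≤_] M W d)
      eci-correct = weaken ≤-refl (λ _ eq → trans eq result) (eciE (input M W) initial)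

theorem8 : Σ[ prog ∈ Program ] Σ[ poly ∈ Poly ] (∀ {n : ℕ} (M : PlanningModel n) (W : ℚ) → 0ℚ ℚ.≤ W →
    ∀ (d : ℕ) .{{_ : NonZero d}} → IsDistance M d →
    ∃[ m ] ∃[ τ ] (Run prog (input M W) m τ × output m ≡ Pr[X≤_] M W d ×
    (∀ k → IsFes (PlanningModel.G M) k → τ ≤ 2 ^ k * evalPoly poly n)))
theorem8 = eci , timePoly , λ {n} M W _ d distance →
  let open Traversal M
      exec {m} {τ} run τ≤ out = eci-correct W d distance
  in m , τ , run , out , λ k fes → begin
       τ                                ≤⟨ τ≤ ⟩
       longestRow W * eciTime n         ≡⟨ cong (longestRow W *_) (eciTime-poly n) ⟩
       longestRow W * evalPoly timePoly n  ≤⟨ *-monoˡ-≤ (evalPoly timePoly n) (longestRow≤2^ W fes) ⟩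
       2 ^ k * evalPoly timePoly n      ∎
  where open ≤-Reasoning
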